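{- Fix $\alpha\in\{\text{rotor routing},\ \text{Bernardi}\}$, and for a ribbon graph $(H,\sigma)$ and $u\in V(H)$ write $\alpha_u^{H}$ for the corresponding sandpile torsor with basepoint $u$. There exist ribbon graphs $(G,\rho)$ and $(G',\rho')$ of genera $g\neq g'$ with $V(G)=V(G')$, a subset $V_{gen}\subseteq V(G)$ satisfying Properties 1 and 2 below, and a bijection $\varphi:\mathcal T(G)\to\mathcal T(G')$ such that, with $\hat\gamma:\operatorname{Pic}^0(G)\to\operatorname{Pic}^0(G')$ the isomorphism induced by the identity on $V_{gen}$, for every $v\in V(G)$, $S\in\operatorname{Pic}^0(G)$, $T\in\mathcal T(G)$: $$\varphi\big(\alpha_v^{G}(S,T)\big)=\alpha_v^{G'}\big(\hat\gamma(S),\varphi(T)\big).$$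
   Context: Graphs are finite and connected, may have multiple edges, and have no loops. $\mathcal T(G)$ is the set of spanning trees (subsets of $E(G)$). A ribbon graph $(G,\rho)$ assigns to each vertex $u$ a cyclic order $\rho_u$ on the edges incident to $u$. $\operatorname{Div}^0(G)$: integer chip configurations of total degree 0; firing $u$ moves one chip from $u$ along each incident edge; $\operatorname{Pic}^0(G)$ is $\operatorname{Div}^0(G)$ modulo the subgroup generated by firings (the image of the Laplacian); $\operatorname{Pic}^k(G)$ is defined likewise for degree $k$. For graphs $G,G'$ on the same vertex set and $V_{gen}\subseteq V(G)$: Property 1: every element of $\operatorname{Pic}^0(G)$ and every element of $\operatorname{Pic}^0(G')$ has a representative with no chips outside $V_{gen}$. Property 2: two degree-zero configurations with no chips outside $V_{gen}$ are equivalent in $G$ iff they are equivalent in $G'$. Then $\hat\gamma(S)$ is defined by choosing a representative of $S$ supported on $V_{gen}$ and taking its class in $\operatorname{Pic}^0(G')$ (same chip counts on each vertex). Rotor routing torsor $r_v$: for $S\in\operatorname{Pic}^0(G)$, $T\in\mathcal T(G)$, choose a representative of $S$ nonnegative away from $v$; orient $T$ towards $v$ so each $u\ne v$ has an outgoing edge (rotor). While some $u\neq v$ has positive chips, advance the rotor at $u$ to the next edge of $\rho_u$ and send a chip from $u$ along it. When all vertices other than $v$ have zero chips, the rotors form the spanning tree $r_v(S,T)$ (well defined; a free transitive action). Bernardi torsor $\beta_v$: with half-edges $(e,u)$ for $u$ an endpoint of $e$, for $T\in\mathcal T(G)$ start at $(e_0,v)$ for a fixed edge $e_0$ at $v$;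 at $(e',v')$: if $e'\in T$ with other endpoint $w'$, move to $(e'',w')$, $e''$ following $e'$ in $\rho_{w'}$; if $e'\notin T$, move to $(\tilde e,v')$, $\tilde e$ following $e'$ in $\rho_{v'}$, placing a chip on $v'$ if the other half-edge of $e'$ was not yet visited. Stop on returning to $(e_0,v)$. The resulting divisors $D_T$ of degree $k=|E|-|V|+1$ give a bijection $T\mapsto[D_T]\in\operatorname{Pic}^k(G)$, and $\beta_v(S,T)$ is the unique $T'$ with $[D_{T'}]=[D_T]+S$. Genus: a cycle of $(G,\rho)$ is a closed walk that, on entering $u$ along $e$, leaves along the edge following $e$ in $\rho_u$; with $\operatorname{cyc}(G,\rho)$ the number of cycles, the genus $g$ satisfies $2g=2-|V(G)|+|E(G)|-\operatorname{cyc}(G,\rho)$. -}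

module Defs where

open import Data.Bool.Base using (if_then_else_; not; _∧_)
open import Data.Fin.Base using (Fin)
open import Data.Fin.Properties using (_≟_)
open import Data.Fin.Subset using (Subset; _∈_; ⊤)
open import Data.Fin.Subset.Properties using (_∈?_)
open import Data.Integer.Base using (ℤ; +_; 0ℤ; 1ℤ; -1ℤ; -_; _+_; _-_; _*_; _<_; _≤_)
import Data.Integer.Properties as ℤ
open import Data.List.Base using (List; []; _∷_; iterate)
import Data.List.Membership.DecPropositional as ListMembership
open import Data.List.Relation.Unary.Unique.Propositional using (Unique)
open import Data.Nat.Base as ℕ using (ℕ; NonZero)
open import Data.Nat.GeneralisedArithmetic using (fold)
open import Data.Product.Base using (Σ-syntax; ∃-syntax; _×_; _,_; proj₁; proj₂)
open import Data.Sum.Base using (_⊎_; inj₁; inj₂)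
open import Data.Vec.Functional using (Vector)
open import Function.Bundles using (Func; Bijection; _⇔_; Equivalence)
open import Level using (0ℓ)
open import Relation.Binary.Bundles using (Setoid)
import Relation.Binary.Construct.Closure.Equivalence as EqClosure
open import Relation.Binary.Construct.Closure.ReflexiveTransitive using (Star)
import Relation.Binary.Construct.On as On
open import Relation.Binary.Definitions using (DecidableEquality)
open import Relation.Binary.PropositionalEquality
open import Relation.Binary.Structures using (IsEquivalence)
open import Relation.Nullary using (¬_; Dec; yes; no; does)
open import Relation.Nullary.Decidable using (_⊎-dec_; map′; _×-dec_)
open import Algebra.Properties.Semiring.Sum ℤ.+-*-semiring
  using (sum; sum-syntax; sum-cong-≗; ∑-distrib-+; *-distribˡ-sum)

-- Vertices are Fin n and edges are Fin #E.  The orientation implicit in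
-- the order of the two endpoints is never used.
record Multigraph (n : ℕ) : Set where
  field
    #E       : ℕ
    ends     : Fin #E → Fin n × Fin n
    loopless : ∀ e → proj₁ (ends e) ≢ proj₂ (ends e)

  Incident : Fin n → Fin #E → Set
  Incident u e = u ≡ proj₁ (ends e) ⊎ u ≡ proj₂ (ends e)

  incident? : ∀ u e → Dec (Incident u e)
  incident? u e = (u ≟ proj₁ (ends e)) ⊎-dec (u ≟ proj₂ (ends e))

  -- The endpoint of e different from u; only meaningful if Incident u e.
  other : Fin #E → Fin n → Fin n
  other e u = if does (u ≟ proj₁ (ends e)) then proj₂ (ends e) else proj₁ (ends e)

  other-incident : ∀ e u → Incident (other e u) e
  other-incident e u with u ≟ proj₁ (ends e)
  ... | yes _ = inj₂ refl
  ... | no  _ = inj₁ refl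

  data Walk (A : Subset #E) : Fin n → Fin n → Set where
    stop : ∀ {u} → Walk A u u
    step : ∀ {u w} e → e ∈ A → Incident u e → Walk A (other e u) w → Walk A u w

  edges : ∀ {A u w} → Walk A u w → List (Fin #E)
  edges stop           = []
  edges (step e _ _ p) = e ∷ edges p

  -- The vertices of a walk without the final one, so that a closed walk
  -- does not list its base point twice.
  vertices : ∀ {A u w} → Walk A u w → List (Fin n)
  vertices stop               = []
  vertices (step {u} _ _ _ p) = u ∷ vertices p

  IsCycle : ∀ {A u} → Walk A u u → Set
  IsCycle p = edges p ≢ [] × Unique (edges p) × Unique (vertices p)

  Connected : Subset #E → Set
  Connected A = ∀ u w → Walk A u w

  Acyclic : Subset #E → Set
  Acyclic A = ∀ {u} (p : Walk A u u) → ¬ IsCycle p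

  IsSpanningTree : Subset #E → Set
  IsSpanningTree A = Connected A × Acyclic A

record Graph (n : ℕ) : Set where
  field
    multigraph : Multigraph n
  open Multigraph multigraph public
  field
    nonEmpty  : NonZero n
    connected : Connected ⊤

  SpanningTree : Set
  SpanningTree = Σ[ A ∈ Subset #E ] IsSpanningTree A

-- Spanning trees are compared as sets of edges.
𝒯 : ∀ {n} → Graph n → Setoid 0ℓ 0ℓ
𝒯 G = On.setoid {B = SpanningTree} (setoid (Subset #E)) proj₁
  where open Graph G

Div : ℕ → Set
Div n = Vector ℤ n

deg : ∀ {n} → Div n → ℤ
deg = sum

Div⁰ : ℕ → Set
Div⁰ n = Σ[ D ∈ Div n ] deg D ≡ 0ℤ

SupportedOn : ∀ {n} → Subset n → Div⁰ n → Set
SupportedOn Vgen D = ∀ u → ¬ u ∈ Vgen → proj₁ D u ≡ 0ℤ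

infixl 6 _⊕_

_⊕_ : ∀ {n} → Div n → Div n → Div n
(D ⊕ D′) w = D w + D′ w

chip : ∀ {n} → Fin n → Div n
chip u w = if does (u ≟ w) then 1ℤ else 0ℤ

module _ {n : ℕ} (G : Graph n) where
  open Graph G

  -- The change of configuration when u sends one chip along e.
  send : Fin n → Fin #E → Div n
  send u e w = chip (other e u) w - chip u w

  firing : Fin n → Div n
  firing u w = ∑[ e < #E ] (if does (incident? u e) then send u e w else 0ℤ)

  fire : Vector ℤ n → Div n
  fire f w = ∑[ u < n ] (f u * firing u w)

  infix 4 _∼_

  _∼_ : Div n → Div n → Set
  D ∼ D′ = Σ[ f ∈ Vector ℤ n ] (∀ w → D′ w ≡ D w + fire f w)

  fire-scale : ∀ c f w → fire (λ u → c * f u) w ≡ c * fire f w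
  fire-scale c f w = trans
    (sum-cong-≗ (λ u → ℤ.*-assoc c (f u) (firing u w)))
    (sym (*-distribˡ-sum c (λ u → f u * firing u w)))

  fire-+ : ∀ f g w → fire (λ u → f u + g u) w ≡ fire f w + fire g w
  fire-+ f g w = trans
    (sum-cong-≗ (λ u → ℤ.*-distribʳ-+ (firing u w) (f u) (g u)))
    (∑-distrib-+ (λ u → f u * firing u w) (λ u → g u * firing u w))

  ∼-isEquivalence : IsEquivalence _∼_
  ∼-isEquivalence = record
    { refl  = λ {D} → (λ u → 0ℤ * 0ℤ) , λ w → sym (begin
        D w + fire (λ _ → 0ℤ * 0ℤ) w       ≡⟨ cong (λ x → D w + x) (fire-scale 0ℤ (λ _ → 0ℤ) w) ⟩
        D w + 0ℤ                           ≡⟨ ℤ.+-identityʳ (D w) ⟩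
        D w                                ∎)
    ; sym   = λ {D} {D′} (f , eq) → (λ u → -1ℤ * f u) , λ w → sym (begin
        D′ w + fire (λ u → -1ℤ * f u) w    ≡⟨ cong₂ _+_ (eq w) (fire-scale -1ℤ f w) ⟩
        (D w + fire f w) + -1ℤ * fire f w  ≡⟨ cong (λ x → D w + fire f w + x) (ℤ.-1*i≡-i (fire f w)) ⟩
        (D w + fire f w) + (- fire f w)    ≡⟨ ℤ.+-assoc (D w) _ _ ⟩
        D w + (fire f w + (- fire f w))    ≡⟨ cong (λ x → D w + x) (ℤ.+-inverseʳ (fire f w)) ⟩
        D w + 0ℤ                           ≡⟨ ℤ.+-identityʳ (D w) ⟩
        D w                                ∎)
    ; trans = λ {D} {D′} {D″} (f , eq) (g , eq′) → (λ u → f u + g u) , λ w → begin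
        D″ w                               ≡⟨ eq′ w ⟩
        D′ w + fire g w                    ≡⟨ cong (λ x → x + fire g w) (eq w) ⟩
        (D w + fire f w) + fire g w        ≡⟨ ℤ.+-assoc (D w) _ _ ⟩
        D w + (fire f w + fire g w)        ≡⟨ cong (λ x → D w + x) (fire-+ f g w) ⟨
        D w + fire (λ u → f u + g u) w     ∎
    }
    where open ≡-Reasoning

  Pic⁰ : Setoid 0ℓ 0ℓ
  Pic⁰ = On.setoid {B = Div⁰ n} (record { isEquivalence = ∼-isEquivalence }) proj₁

module _ {n : ℕ} (G G′ : Graph n) (Vgen : Subset n) where

  Representable : Graph n → Set
  Representable H = ∀ S → Σ[ D ∈ Div⁰ n ] SupportedOn Vgen D × Setoid._≈_ (Pic⁰ H) D S

  Property1 : Set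
  Property1 = Representable G × Representable G′

  Property2 : Set
  Property2 = ∀ D D′ → SupportedOn Vgen D → SupportedOn Vgen D′ →
    Setoid._≈_ (Pic⁰ G) D D′ ⇔ Setoid._≈_ (Pic⁰ G′) D D′

  γ̂ : Property1 → Property2 → Func (Pic⁰ G) (Pic⁰ G′)
  γ̂ (rep , _) P2 = record
    { to   = λ S → proj₁ (rep S)
    ; cong = λ {S} {S′} S≈S′ →
        let (D , D-supp , D≈S) = rep S
            (D′ , D′-supp , D′≈S′) = rep S′
        in Equivalence.to (P2 D D′ D-supp D′-supp)
             (Pic.trans {D} {S} {D′} D≈S
               (Pic.trans {S} {S′} {D′} S≈S′ (Pic.sym {D′} {S′} D′≈S′)))
    }
    where module Pic = Setoid (Pic⁰ G)

record RibbonGraph (n : ℕ) : Set where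
  field
    graph : Graph n
  open Graph graph public
  field
    -- ρ u e is the edge following e around u; only meaningful if
    -- Incident u e.  Transitivity on the edges at u makes ρ u a single
    -- cyclic permutation of them.
    ρ          : Fin n → Fin #E → Fin #E
    ρ-incident : ∀ {u e} → Incident u e → Incident u (ρ u e)
    ρ-cyclic   : ∀ {u e e′} → Incident u e → Incident u e′ → ∃[ k ] fold e (ρ u) k ≡ e′

  record HalfEdge : Set where
    constructor half
    eta-equality
    field
      edge      : Fin #E
      vertex    : Fin n
      .incident : Incident vertex edge

  open HalfEdge public

  infix 4 _≟ₕ_

  _≟ₕ_ : DecidableEquality HalfEdge
  half e u _ ≟ₕ half e′ u′ _ = map′ (λ { (refl , refl) → refl }) (λ { refl → refl , refl })
    ((e ≟ e′) ×-dec (u ≟ u′))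

  opposite : HalfEdge → HalfEdge
  opposite (half e u _) = half e (other e u) (other-incident e u)

  rotate : HalfEdge → HalfEdge
  rotate (half e u i) = half (ρ u e) u (ρ-incident i)

  -- A half-edge (e , u) stands for traversing e starting from u; a cycle
  -- of the ribbon graph is then an orbit of h ↦ rotate (opposite h).
  cycles : Setoid 0ℓ 0ℓ
  cycles = EqClosure.setoid (λ h h′ → rotate (opposite h) ≡ h′)

  Cyc : ℕ → Set
  Cyc c = Bijection cycles (setoid (Fin c))

  Genus : ℕ → Set
  Genus g = ∃[ c ] Cyc c × + 2 * + g ≡ + 2 - + n + + #E - + c

module RotorRouting {n : ℕ} (H : RibbonGraph n) (v : Fin n) where
  open RibbonGraph H

  Rotors : Set
  Rotors = ∀ u → .(u ≢ v) → Fin #E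

  -- Following the rotors from a vertex ends at v.
  data LeadsToRoot (R : Rotors) : Fin n → Set where
    here  : LeadsToRoot R v
    there : ∀ {u} (u≢v : u ≢ v) → LeadsToRoot R (other (R u u≢v) u) → LeadsToRoot R u

  OrientsTowards : Subset #E → Rotors → Set
  OrientsTowards T R =
    (∀ u (u≢v : u ≢ v) → R u u≢v ∈ T × Incident u (R u u≢v)) ×
    (∀ u → LeadsToRoot R u)

  Forms : Rotors → Subset #E → Set
  Forms R T = ∀ e → e ∈ T ⇔ (Σ[ u ∈ Fin n ] Σ[ u≢v ∈ u ≢ v ] R u u≢v ≡ e)

  advance : Fin n → Rotors → Rotors
  advance u R w w≢v = if does (w ≟ u) then ρ w (R w w≢v) else R w w≢v

  data _⟶_ : Div n × Rotors → Div n × Rotors → Set where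
    route : ∀ {D R} u (u≢v : u ≢ v) → 0ℤ < D u →
      (D , R) ⟶ (D ⊕ send graph u (advance u R u u≢v) , advance u R)

  record Result (S : Div⁰ n) (T T′ : Subset #E) : Set where
    field
      {D D′}      : Div n
      {R R′}      : Rotors
      represents  : _∼_ graph D (proj₁ S)
      nonnegative : ∀ u → u ≢ v → 0ℤ ≤ D u
      oriented    : OrientsTowards T R
      run         : Star _⟶_ (D , R) (D′ , R′)
      finished    : ∀ u → u ≢ v → D′ u ≡ 0ℤ
      forms       : Forms R′ T′

module Bernardi {n : ℕ} (H : RibbonGraph n) where
  open RibbonGraph H

  open ListMembership _≟ₕ_ using () renaming (_∈?_ to _∈ₗ?_)

  next : Subset #E → HalfEdge → HalfEdge
  next T h = if does (edge h ∈? T) then rotate (opposite h) else rotate h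

  FirstReturn : Subset #E → HalfEdge → ℕ → Set
  FirstReturn T h₀ k = 0 ℕ.< k × fold h₀ (next T) k ≡ h₀ ×
    (∀ j → 0 ℕ.< j → j ℕ.< k → fold h₀ (next T) j ≢ h₀)

  -- The chips placed at the half-edges remaining in a tour, given those
  -- already passed (most recent first).
  chips : Subset #E → (visited remaining : List HalfEdge) → Div n
  chips T visited []       w = 0ℤ
  chips T visited (h ∷ hs) w =
    (if not (does (edge h ∈? T)) ∧ not (does (opposite h ∈ₗ? visited))
     then chip (vertex h) w else 0ℤ)
    + chips T (h ∷ visited) hs w

  TourDivisor : HalfEdge → Subset #E → Div n → Set
  TourDivisor h₀ T D = Σ[ k ∈ ℕ ] FirstReturn T h₀ k × D ≡ chips T [] (iterate (next T) h₀ k)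

  record Result (v : Fin n) (S : Div⁰ n) (T T′ : Subset #E) : Set where
    field
      {D D′}     : Div n
      start      : HalfEdge
      at-v       : vertex start ≡ v
      divisor    : TourDivisor start T D
      divisor′   : TourDivisor start T′ D′
      equivalent : _∼_ graph D′ (D ⊕ proj₁ S)

data Process : Set where
  rotorRouting bernardi : Process

Yields : Process → ∀ {n} (H : RibbonGraph n) (v : Fin n) (S : Div⁰ n) (T T′ : RibbonGraph.SpanningTree H) → Set
Yields rotorRouting H v S T T′ = RotorRouting.Result H v S (proj₁ T) (proj₁ T′)
Yields bernardi     H v S T T′ = Bernardi.Result H v S (proj₁ T) (proj₁ T′)

-- The maps (S , T) ↦ α_v(S , T) for all basepoints v at once.  The
-- equivalence says that act v S T is the outcome of the process for some,
-- and hence for every, choice made along the way (of a representative of S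
-- and the order of routing, respectively of the starting edge at v).  It
-- determines act up to equality of spanning trees, and makes act v S T
-- depend only on the class of S and the edge set of T.
record Torsor (α : Process) {n : ℕ} (H : RibbonGraph n) : Set where
  open RibbonGraph H
  field
    act     : Fin n → Div⁰ n → SpanningTree → SpanningTree
    outcome : ∀ v S T T′ → Yields α H v S T T′ ⇔ Setoid._≈_ (𝒯 graph) (act v S T) T′

module Submission where

-- Both graphs are wedges of two banana graphs, with p edges joining 0 to 1
-- and q edges joining 0 to 2: (p , q) is (3 , 2) for G, of genus 1, and
-- (6 , 1) for G′, of genus 2.  Either Picard group is ℤ/6, an explicit
-- potential h on the vertices giving the isomorphism D ↦ Σ h(u) D(u).  The
-- spanning trees are numbered by i ∈ ℤ/6 as {i mod p , p + i mod q}, and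
-- for a suitable cyclic order at each vertex a class of value x moves tree i
-- to tree i ± x in both graphs, the sign depending only on the process and
-- on the base point.  As h is 1 at vertex 1 and 0 at vertex 2 in both
-- graphs, Vgen = {1 , 2} and i ↦ i work.
--
-- For rotor routing, value(D) + Σ w(u , rotor at u) is invariant for
-- suitable weights w, so the final tree is determined by the initial data;
-- that routing terminates from one representative of each class is
-- established by running it.

open import Defs
open import Data.Bool.Base using (if_then_else_)
import Data.Bool.Properties as Bool
open import Data.Fin.Base using (Fin; zero; suc; toℕ; fromℕ<; _↑ˡ_; _↑ʳ_; splitAt)
open import Data.Fin.Properties using (_≟_; all?; any?; suc-injective; toℕ-fromℕ<; splitAt-↑ˡ; splitAt-↑ʳ; join-splitAt)
open import Data.Fin.Subset using (Subset; inside; outside; _∈_; ⁅_⁆; _∪_)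
open import Data.Fin.Subset.Properties using (∈⊤; x∈⁅x⁆; x∈⁅y⁆⇒x≡y; x∈p∪q⁻; x∈p∪q⁺; ⊆-antisym)
open import Data.Integer.Base as ℤ using (ℤ; +_; -_; _+_; _-_; _*_; 0ℤ; 1ℤ; -1ℤ; _<_; _≤_)
open import Data.Integer.Divisibility.Signed using (_∣_; divides; _∣?_; ∣m∣n⇒∣m+n; ∣m⇒∣-m; ∣n⇒∣m*n)
open import Data.Integer.DivMod using (_%ℕ_; _/ℕ_; n%ℕd<d; a≡a%ℕn+[a/ℕn]*n)
import Data.Integer.Properties as ℤ
open import Data.Integer.Tactic.RingSolver using (solve-∀)
import Data.List.Base as List
import Data.List.Relation.Unary.All as All
import Data.List.Relation.Unary.AllPairs.Core as AllPairs
open import Data.List.Relation.Unary.Unique.Propositional using (Unique)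
open import Data.Nat.Base as ℕ using (ℕ; zero; suc)
open import Data.Nat.DivMod using (_mod_)
open import Data.Nat.GeneralisedArithmetic using (fold)
import Data.Nat.Properties as ℕ
open import Data.Product.Base using (Σ-syntax; ∃-syntax; _×_; _,_; proj₁; proj₂)
open import Data.Sum.Base using (_⊎_; inj₁; inj₂; [_,_]′; map)
open import Data.Vec.Base as Vec using (Vec; lookup; tabulate; _[_]≔_; here; there)
open import Data.Vec.Functional using (Vector; []; _∷_)
open import Data.Vec.Properties using (lookup∘tabulate; lookup∘update; lookup∘update′; ≡-dec)
open import Function.Base using (_∘_; const; case_of_)
open import Function.Bundles using (Func; Bijection; mk⇔; Equivalence)
open import Relation.Binary.Bundles using (Setoid)
open import Relation.Binary.Construct.Closure.Equivalence as EqClosure using (EqClosure)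
open import Relation.Binary.Construct.Closure.ReflexiveTransitive using (Star; ε; _◅_)
open import Relation.Binary.Definitions using (tri<; tri≈; tri>)
open import Relation.Binary.PropositionalEquality
import Relation.Binary.Reasoning.Setoid as SetoidReasoning
open import Relation.Nullary using (¬_; Dec; yes; no; does; contradiction; ¬?)
open import Relation.Nullary.Decidable using (_×-dec_; _→-dec_; map′; from-yes; recompute)
open import Algebra.Properties.Semiring.Sum ℤ.+-*-semiring
  using (sum; sum-syntax; sum-cong-≗; ∑-distrib-+; *-distribˡ-sum; ∑-comm)

pattern 0F = zero
pattern 1F = suc zero
pattern 2F = suc (suc zero)

-- Congruence modulo 6 and the value of a divisor

infix 4 _≋_ _≋?_

-- A record, because `x` and `y` could not be inferred from the bare divisibility of their
-- difference.
record _≋_ (x y : ℤ) : Set where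
  constructor congruent
  field divisible : + 6 ∣ x - y

_≋?_ : ∀ x y → Dec (x ≋ y)
x ≋? y = map′ congruent _≋_.divisible (+ 6 ∣? x - y)

≡⇒≋ : ∀ {x y} → x ≡ y → x ≋ y
≡⇒≋ {x} refl = congruent (divides 0ℤ (ℤ.+-inverseʳ x))

≋-sym : ∀ {x y} → x ≋ y → y ≋ x
≋-sym {x} {y} (congruent d) = congruent (subst (+ 6 ∣_) (lemma x y) (∣m⇒∣-m d))
  where
  lemma : ∀ x y → - (x - y) ≡ y - x
  lemma = solve-∀

≋-trans : ∀ {x y z} → x ≋ y → y ≋ z → x ≋ z
≋-trans {x} {y} {z} (congruent d) (congruent e) = congruent (subst (+ 6 ∣_) (lemma x y z) (∣m∣n⇒∣m+n d e))
  where
  lemma : ∀ x y z → (x - y) + (y - z) ≡ x - z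
  lemma = solve-∀

≋-+ : ∀ {x y z w} → x ≋ y → z ≋ w → x + z ≋ y + w
≋-+ {x} {y} {z} {w} (congruent d) (congruent e) = congruent (subst (+ 6 ∣_) (lemma x y z w) (∣m∣n⇒∣m+n d e))
  where
  lemma : ∀ x y z w → (x - y) + (z - w) ≡ (x + z) - (y + w)
  lemma = solve-∀

≋-* : ∀ c {x y} → x ≋ y → c * x ≋ c * y
≋-* c {x} {y} (congruent d) = congruent (subst (+ 6 ∣_) (lemma c x y) (∣n⇒∣m*n c d))
  where
  lemma : ∀ c x y → c * (x - y) ≡ c * x - c * y
  lemma = solve-∀

≋-setoid : Setoid _ _
≋-setoid = record
  { _≈_ = _≋_
  ; isEquivalence = record { refl = ≡⇒≋ refl ; sym = ≋-sym ; trans = ≋-trans }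
  }

module ≋-Reasoning = SetoidReasoning ≋-setoid

residue : ℤ → Fin 6
residue x = fromℕ< (n%ℕd<d x 6)

⟦_⟧ : Fin 6 → ℤ
⟦ i ⟧ = + toℕ i

residue-≋ : ∀ x → ⟦ residue x ⟧ ≋ x
residue-≋ x = ≋-sym (congruent (divides (x /ℕ 6) (begin
  x - ⟦ residue x ⟧                       ≡⟨ cong (λ r → x - + r) (toℕ-fromℕ< (n%ℕd<d x 6)) ⟩
  x - + (x %ℕ 6)                          ≡⟨ cong (_- + (x %ℕ 6)) (a≡a%ℕn+[a/ℕn]*n x 6) ⟩
  + (x %ℕ 6) + (x /ℕ 6) * + 6 - + (x %ℕ 6) ≡⟨ lemma (+ (x %ℕ 6)) ((x /ℕ 6) * + 6) ⟩
  (x /ℕ 6) * + 6                          ∎)))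
  where
  open ≡-Reasoning
  lemma : ∀ r s → r + s - r ≡ s
  lemma = solve-∀

-- Residues below 6 differ by less than 6; all 36 pairs are checked.
≋⇒≡ : ∀ {i j} → ⟦ i ⟧ ≋ ⟦ j ⟧ → i ≡ j
≋⇒≡ {i} {j} = from-yes (all? λ i → all? λ j → (⟦ i ⟧ ≋? ⟦ j ⟧) →-dec (i ≟ j)) i j

residue-cong : ∀ {x y} → x ≋ y → residue x ≡ residue y
residue-cong {x} {y} x≋y = ≋⇒≡ (≋-trans (residue-≋ x) (≋-trans x≋y (≋-sym (residue-≋ y))))

-- Translation of ℤ/6: the effect on tree numbers of a class of value `x`, with sign `σ`.
move : ℤ → Fin 6 → ℤ → Fin 6
move σ i x = residue (⟦ i ⟧ + σ * x)

move-cong : ∀ σ i {x y} → x ≋ y → move σ i x ≡ move σ i y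
move-cong σ i x≋y = residue-cong (≋-+ (≡⇒≋ {⟦ i ⟧} refl) (≋-* σ x≋y))

module _ {n : ℕ} (h : Vector ℤ n) where

  val : Div n → ℤ
  val D = ∑[ u < n ] (h u * D u)

  val-cong : ∀ {D D′} → (∀ u → D u ≡ D′ u) → val D ≡ val D′
  val-cong D≗D′ = sum-cong-≗ (λ u → cong (h u *_) (D≗D′ u))

  val-⊕ : ∀ D D′ → val (D ⊕ D′) ≡ val D + val D′
  val-⊕ D D′ = trans
    (sum-cong-≗ (λ u → ℤ.*-distribˡ-+ (h u) (D u) (D′ u)))
    (∑-distrib-+ (λ u → h u * D u) (λ u → h u * D′ u))

  -- Interchanging the two sums leaves only the values of single firings to be controlled.
  val-fire : ∀ G f → val (fire G f) ≡ ∑[ u < n ] (f u * val (firing G u))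
  val-fire G f = begin
    ∑[ w < n ] (h w * ∑[ u < n ] (f u * firing G u w))
      ≡⟨ sum-cong-≗ (λ w → *-distribˡ-sum (h w) (λ u → f u * firing G u w)) ⟩
    ∑[ w < n ] ∑[ u < n ] (h w * (f u * firing G u w))
      ≡⟨ ∑-comm (λ w u → h w * (f u * firing G u w)) ⟩
    ∑[ u < n ] ∑[ w < n ] (h w * (f u * firing G u w))
      ≡⟨ sum-cong-≗ (λ u → trans
           (sum-cong-≗ (λ w → lemma (h w) (f u) (firing G u w)))
           (sym (*-distribˡ-sum (f u) (λ w → h w * firing G u w)))) ⟩
    ∑[ u < n ] (f u * val (firing G u)) ∎
    where
    open ≡-Reasoning
    lemma : ∀ x y z → x * (y * z) ≡ y * (x * z)
    lemma = solve-∀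

  -- The condition for `val h` to descend to a homomorphism from `Pic⁰ G` to ℤ/6.
  Harmonic : Graph n → Set
  Harmonic G = ∀ u → val (firing G u) ≋ 0ℤ

  harmonic? : ∀ G → Dec (Harmonic G)
  harmonic? G = all? λ u → val (firing G u) ≋? 0ℤ

sum-≋0 : ∀ {n} (t : Vector ℤ n) → (∀ i → t i ≋ 0ℤ) → sum t ≋ 0ℤ
sum-≋0 {zero}  t t≋0 = ≡⇒≋ refl
sum-≋0 {suc n} t t≋0 = ≋-+ (t≋0 zero) (sum-≋0 (λ i → t (suc i)) (λ i → t≋0 (suc i)))

∼⇒val≋ : ∀ {n} (h : Vector ℤ n) (G : Graph n) → Harmonic h G → ∀ {D D′} → _∼_ G D D′ → val h D ≋ val h D′
∼⇒val≋ h G harmonic {D} {D′} (f , eq) = begin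
  val h D                       ≡⟨ ℤ.+-identityʳ (val h D) ⟨
  val h D + 0ℤ                  ≈⟨ ≋-+ (≡⇒≋ {val h D} refl) fire≋0 ⟨
  val h D + val h (fire G f)    ≡⟨ val-⊕ h D (fire G f) ⟨
  val h (D ⊕ fire G f)          ≡⟨ val-cong h eq ⟨
  val h D′                      ∎
  where
  open ≋-Reasoning
  fire≋0 : val h (fire G f) ≋ 0ℤ
  fire≋0 = subst (_≋ 0ℤ) (sym (val-fire h G f)) (sum-≋0 _ (λ u →
    subst (f u * val h (firing G u) ≋_) (ℤ.*-zeroʳ (f u)) (≋-* (f u) (harmonic u))))

module _ (h₀ : ℤ) where

  potential : Vector ℤ 3
  potential = h₀ ∷ 1ℤ ∷ 0ℤ ∷ []

  -- Generators of the group of degree 0 divisors of value ≋ 0.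
  α β : Div 3
  α = 1ℤ ∷ - h₀ ∷ h₀ - 1ℤ ∷ []
  β = 0ℤ ∷ + 6 ∷ - (+ 6) ∷ []

  -- Solves D′ - D = xα - cβ: the coefficient of α is the change at vertex 0, and that of β comes
  -- from the difference of values, a multiple of 6. The firing vectors `a` and `b` realise the two
  -- generators.
  val≋⇒∼ : (G : Graph 3) (a b : Vector ℤ 3) → (∀ w → fire G a w ≡ α w) → (∀ w → fire G b w ≡ β w) →
    ∀ {D D′} → deg D ≡ deg D′ → val potential D ≋ val potential D′ → _∼_ G D D′
  val≋⇒∼ G a b fire-a fire-b {D} {D′} deg≡ (congruent (divides c eq)) =
    (λ u → x * a u + - c * b u) , λ w → trans (target w) (cong (_+_ (D w)) (sym (fires w)))
    where
    open ≡-Reasoning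
    x = D′ 0F - D 0F
    fires : ∀ w → fire G (λ u → x * a u + - c * b u) w ≡ x * α w + - c * β w
    fires w = begin
      fire G (λ u → x * a u + - c * b u) w                     ≡⟨ fire-+ G (λ u → x * a u) (λ u → - c * b u) w ⟩
      fire G (λ u → x * a u) w + fire G (λ u → - c * b u) w    ≡⟨ cong₂ _+_ (fire-scale G x a w) (fire-scale G (- c) b w) ⟩
      x * fire G a w + - c * fire G b w                        ≡⟨ cong₂ (λ y z → x * y + - c * z) (fire-a w) (fire-b w) ⟩
      x * α w + - c * β w                                      ∎
    lemma₀ : ∀ d d′ c → d′ ≡ d + ((d′ - d) * 1ℤ + - c * 0ℤ)
    lemma₀ = solve-∀
    -- Here and in `lemma₂` the nested sums are `val potential` and `deg` written out for the ring
    -- solver.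
    lemma₁ : ∀ h d₀ d₁ d₂ e₀ e₁ e₂ → e₁ ≡ d₁ + ((e₀ - d₀) * - h +
      - ((h * d₀ + (1ℤ * d₁ + (0ℤ * d₂ + 0ℤ))) - (h * e₀ + (1ℤ * e₁ + (0ℤ * e₂ + 0ℤ)))))
    lemma₁ = solve-∀
    lemma₂ : ∀ h d₀ d₁ d₂ e₀ e₁ e₂ → e₂ + ((d₀ + (d₁ + (d₂ + 0ℤ))) - (e₀ + (e₁ + (e₂ + 0ℤ)))) ≡ d₂ + ((e₀ - d₀) * (h - 1ℤ) +
      ((h * d₀ + (1ℤ * d₁ + (0ℤ * d₂ + 0ℤ))) - (h * e₀ + (1ℤ * e₁ + (0ℤ * e₂ + 0ℤ)))))
    lemma₂ = solve-∀
    neg : ∀ c d → - (c * d) ≡ - c * d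
    neg = solve-∀
    neg² : ∀ c d → c * d ≡ - c * - d
    neg² = solve-∀
    target : ∀ w → D′ w ≡ D w + (x * α w + - c * β w)
    target 0F = lemma₀ (D 0F) (D′ 0F) c
    target 1F = trans (lemma₁ h₀ (D 0F) (D 1F) (D 2F) (D′ 0F) (D′ 1F) (D′ 2F))
      (cong (λ y → D 1F + (x * - h₀ + y)) (trans (cong -_ eq) (neg c (+ 6))))
    -- Only this last coordinate draws on the equality of degrees.
    target 2F = begin
      D′ 2F                         ≡⟨ ℤ.+-identityʳ (D′ 2F) ⟨
      D′ 2F + 0ℤ                    ≡⟨ cong (_+_ (D′ 2F)) (trans (cong (_- deg D′) deg≡) (ℤ.+-inverseʳ (deg D′))) ⟨
      D′ 2F + (deg D - deg D′)      ≡⟨ lemma₂ h₀ (D 0F) (D 1F) (D 2F) (D′ 0F) (D′ 1F) (D′ 2F) ⟩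
      D 2F + (x * (h₀ - 1ℤ) + (val potential D - val potential D′)) ≡⟨ cong (λ y → D 2F + (x * (h₀ - 1ℤ) + y)) (trans eq (neg² c (+ 6))) ⟩
      D 2F + (x * α 2F + - c * β 2F) ∎

-- Invariants affine in the tree number

Affine : ℤ → (Fin 6 → ℤ) → Set
Affine σ V = ∀ i → V i ≋ V 0F + σ * ⟦ i ⟧

affine? : ∀ σ V → Dec (Affine σ V)
affine? σ V = all? λ i → V i ≋? V 0F + σ * ⟦ i ⟧

module _ (σ : ℤ) (σ² : σ * σ ≡ 1ℤ) (V : Fin 6 → ℤ) (affine : Affine σ V) where

  private
    c = V 0F

    square : ∀ y → σ * σ * y ≡ y
    square y = trans (cong (_* y) σ²) (ℤ.*-identityˡ y)

  -- As σ² = 1, an affine `V` can be solved for its argument. This yields uniqueness of outcomes.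
  affine⇒move : ∀ i j x → V i + x ≋ V j → move σ i x ≡ j
  affine⇒move i j x eq = ≋⇒≡ (begin
    ⟦ move σ i x ⟧                                 ≈⟨ residue-≋ (⟦ i ⟧ + σ * x) ⟩
    ⟦ i ⟧ + σ * x                                  ≡⟨ cong (_+ σ * x) (square ⟦ i ⟧) ⟨
    σ * σ * ⟦ i ⟧ + σ * x                          ≡⟨ lemma₁ σ c ⟦ i ⟧ x ⟩
    σ * (c + σ * ⟦ i ⟧ + x) + - (σ * c)            ≈⟨ shift (≋-trans (≋-+ (≋-sym (affine i)) (≡⇒≋ {x} refl)) (≋-trans eq (affine j))) ⟩
    σ * (c + σ * ⟦ j ⟧) + - (σ * c)                ≡⟨ lemma₂ σ c ⟦ j ⟧ ⟩
    σ * σ * ⟦ j ⟧                                  ≡⟨ square ⟦ j ⟧ ⟩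
    ⟦ j ⟧                                          ∎)
    where
    open ≋-Reasoning
    lemma₁ : ∀ s c i x → s * s * i + s * x ≡ s * (c + s * i + x) + - (s * c)
    lemma₁ = solve-∀
    lemma₂ : ∀ s c j → s * (c + s * j) + - (s * c) ≡ s * s * j
    lemma₂ = solve-∀
    shift : ∀ {y z} → y ≋ z → σ * y + - (σ * c) ≋ σ * z + - (σ * c)
    shift y≋z = ≋-+ (≋-* σ y≋z) (≡⇒≋ { - (σ * c)} refl)

  -- The existence half: the translated tree number attains the required value.
  affine-move : ∀ i x → V i + x ≋ V (move σ i x)
  affine-move i x = ≋-sym (begin
    V (move σ i x)                 ≈⟨ affine (move σ i x) ⟩
    c + σ * ⟦ move σ i x ⟧         ≈⟨ ≋-+ (≡⇒≋ {c} refl) (≋-* σ (residue-≋ (⟦ i ⟧ + σ * x))) ⟩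
    c + σ * (⟦ i ⟧ + σ * x)        ≡⟨ lemma σ c ⟦ i ⟧ x ⟩
    c + σ * ⟦ i ⟧ + σ * σ * x      ≡⟨ cong (_+_ (c + σ * ⟦ i ⟧)) (square x) ⟩
    c + σ * ⟦ i ⟧ + x              ≈⟨ ≋-+ (affine i) (≡⇒≋ {x} refl) ⟨
    V i + x                        ∎)
    where
    open ≋-Reasoning
    lemma : ∀ s c i x → c + s * (i + s * x) ≡ c + s * i + s * s * x
    lemma = solve-∀

-- Cycles of a ribbon graph

module HalfEdges {n : ℕ} (H : RibbonGraph n) where
  open RibbonGraph H

  -- A search over all pairs of an edge and a vertex; `recompute` recovers the irrelevant incidence
  -- proof.
  allHalfEdges? : ∀ {P : HalfEdge → Set} → (∀ h → Dec (P h)) → Dec (∀ h → P h)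
  allHalfEdges? {P} P? = map′
    (λ f → λ { (half e u i) → f e u (recompute (incident? u e) i) })
    (λ f e u i → f (half e u i))
    (all? λ e → all? λ u → at e u)
    where
    at : ∀ e u → Dec ((i : Incident u e) → P (half e u i))
    at e u with incident? u e
    ... | yes i = map′ (λ x _ → x) (λ f → f i) (P? (half e u i))
    ... | no ¬i = yes (λ i → contradiction i ¬i)

  advanceCycle : HalfEdge → HalfEdge
  advanceCycle h = rotate (opposite h)

  bases : HalfEdge → HalfEdge → Fin 2 → HalfEdge
  bases r s 0F = r
  bases r s 1F = s

  -- 1 stands for any half-edge outside the cycle of r; only meaningful if
  -- the cycle of s is the only other one.
  cycleOf : HalfEdge → HalfEdge → HalfEdge → Fin 2
  cycleOf r s h = if does (any? λ (k : Fin (2 ℕ.* #E)) → fold r advanceCycle (toℕ k) ≟ₕ h) then 0F else 1F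

  module _ {c : ℕ} (representative : Fin c → HalfEdge) (index : HalfEdge → Fin c) where

    -- A decidable certificate that each cycle has exactly one representative. There are `2 * #E`
    -- half-edges, so an orbit is exhausted within that many steps.
    record Transversal : Set where
      field
        index-advance        : ∀ h → index (advanceCycle h) ≡ index h
        index-representative : ∀ i → index (representative i) ≡ i
        reach                : ∀ h → ∃[ k ] fold (representative (index h)) advanceCycle (toℕ {2 ℕ.* #E} k) ≡ h

    transversal? : Dec Transversal
    transversal? = map′
      (λ (x , y , z) → record { index-advance = x ; index-representative = y ; reach = z })
      (λ t → let open Transversal t in index-advance , index-representative , reach)
      (allHalfEdges? (λ h → index (advanceCycle h) ≟ index h)
        ×-dec all? (λ i → index (representative i) ≟ i)
        ×-dec allHalfEdges? (λ h → any? λ k → fold (representative (index h)) advanceCycle (toℕ k) ≟ₕ h))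

    -- For injectivity, half-edges of equal index lie on the cycle of the same representative.
    cyc : Transversal → Cyc c
    cyc t = record
      { to        = index
      ; cong      = EqClosure.gfold isEquivalence index (λ { {h} refl → sym (index-advance h) })
      ; bijective =
          (λ {h} {h′} eq → EqClosure.transitive _
             (EqClosure.symmetric _ (connect h))
             (subst (λ i → representative i ∼ᶜ h′) (sym eq) (connect h′)))
        , λ i → representative i , λ {h} h∼ → trans
            (EqClosure.gfold isEquivalence index (λ { {h} refl → sym (index-advance h) }) h∼)
            (index-representative i)
      }
      where
      open Transversal t
      _∼ᶜ_ = EqClosure (λ h h′ → advanceCycle h ≡ h′)
      iterates : ∀ h k → h ∼ᶜ fold h advanceCycle k
      iterates h zero    = EqClosure.reflexive _
      iterates h (suc k) = EqClosure.transitive _ (iterates h k) (EqClosure.return refl)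
      connect : ∀ h → representative (index h) ∼ᶜ h
      connect h = let (k , eq) = reach h in subst (representative (index h) ∼ᶜ_) eq (iterates _ (toℕ k))

-- Rotor routing and Bernardi tours

sum-update : ∀ {n} (s t : Vector ℤ n) u → (∀ w → w ≢ u → s w ≡ t w) → sum s ≡ sum t + (s u - t u)
sum-update s t zero agree = trans (cong (_+_ (s zero)) (sum-cong-≗ (λ i → agree (suc i) λ ()))) (lemma (s zero) (t zero) (sum (t ∘ suc)))
  where
  lemma : ∀ a b c → a + c ≡ b + c + (a - b)
  lemma = solve-∀
sum-update s t (suc u) agree = trans
  (cong₂ _+_ (agree zero λ ()) (sum-update (s ∘ suc) (t ∘ suc) u (λ w w≢u → agree (suc w) (w≢u ∘ suc-injective))))
  (sym (ℤ.+-assoc (t zero) _ _))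

module Routing {n : ℕ} (H : RibbonGraph n) (v : Fin n) where
  open RibbonGraph H
  open RotorRouting H v

  advance-same : ∀ u R .u≢v → advance u R u u≢v ≡ ρ u (R u u≢v)
  advance-same u R u≢v with u ≟ u
  ... | yes _   = refl
  ... | no  u≢u = contradiction refl u≢u

  advance-other : ∀ u R {w} .w≢v → w ≢ u → advance u R w w≢v ≡ R w w≢v
  advance-other u R {w} w≢v w≢u with w ≟ u
  ... | yes w≡u = contradiction w≡u w≢u
  ... | no  _   = refl

  module Invariant (h : Vector ℤ n) (weight : Fin n → Fin #E → ℤ) where

    -- Routing a chip out of `u` changes the value of the configuration and the weight of the rotor
    -- by opposite amounts modulo 6.
    Balanced : Set
    Balanced = ∀ u e → Incident u e → weight u (ρ u e) + val h (send graph u (ρ u e)) ≋ weight u e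

    rotorWeight : Rotors → Vector ℤ n
    rotorWeight R u with u ≟ v
    ... | yes _   = 0ℤ
    ... | no  u≢v = weight u (R u u≢v)

    total : Rotors → ℤ
    total R = sum (rotorWeight R)

    total-cong : ∀ {R R′ : Rotors} → (∀ u u≢v → R u u≢v ≡ R′ u u≢v) → total R ≡ total R′
    total-cong {R} {R′} R≗R′ = sum-cong-≗ pointwise
      where
      pointwise : ∀ u → rotorWeight R u ≡ rotorWeight R′ u
      pointwise u with u ≟ v
      ... | yes _   = refl
      ... | no  u≢v = cong (weight u) (R≗R′ u u≢v)

    rotorWeight-≢ : ∀ R {u} (u≢v : u ≢ v) → rotorWeight R u ≡ weight u (R u u≢v)
    rotorWeight-≢ R {u} u≢v with u ≟ v
    ... | yes u≡v = contradiction u≡v u≢v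
    ... | no  _   = refl

    total-advance : ∀ u R (u≢v : u ≢ v) →
      total (advance u R) ≡ total R + (weight u (ρ u (R u u≢v)) - weight u (R u u≢v))
    total-advance u R u≢v = trans
      (sum-update (rotorWeight (advance u R)) (rotorWeight R) u agree)
      (cong₂ (λ x y → total R + (x - y))
        (trans (rotorWeight-≢ (advance u R) u≢v) (cong (weight u) (advance-same u R u≢v)))
        (rotorWeight-≢ R u≢v))
      where
      agree : ∀ w → w ≢ u → rotorWeight (advance u R) w ≡ rotorWeight R w
      agree w w≢u with w ≟ v
      ... | yes _   = refl
      ... | no  w≢v = cong (weight w) (advance-other u R w≢v w≢u)

    -- `Balanced` speaks only of edges at `u`, so this condition is carried along the run.
    AtSource : Rotors → Set
    AtSource R = ∀ u (u≢v : u ≢ v) → Incident u (R u u≢v)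

    advance-atSource : ∀ u R → AtSource R → AtSource (advance u R)
    advance-atSource u R atSource w w≢v with w ≟ u
    ... | yes _ = ρ-incident (atSource w w≢v)
    ... | no  _ = atSource w w≢v

    -- Value plus rotor weight is conserved by each single step, hence by every run in whatever
    -- order vertices are routed.
    invariant : Balanced → ∀ {D R D′ R′} → AtSource R → Star _⟶_ (D , R) (D′ , R′) →
      AtSource R′ × val h D + total R ≋ val h D′ + total R′
    invariant balanced {D} {R} atSource ε = atSource , ≡⇒≋ {val h D + total R} refl
    invariant balanced {D} {R} {D′} {R′} atSource (route u u≢v _ ◅ run) =
      let (atSource′ , rest) = invariant balanced (advance-atSource u R atSource) run
      in atSource′ , ≋-trans (≋-sym one) rest
      where
      e = R u u≢v
      s = val h (send graph u (ρ u e))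
      lemma₁ : ∀ d s t x y → (d + s) + (t + (x - y)) ≡ (d + (t - y)) + (x + s)
      lemma₁ = solve-∀
      lemma₂ : ∀ d t y → (d + (t - y)) + y ≡ d + t
      lemma₂ = solve-∀
      open ≋-Reasoning
      one : val h (D ⊕ send graph u (advance u R u u≢v)) + total (advance u R) ≋ val h D + total R
      one = begin
        val h (D ⊕ send graph u (advance u R u u≢v)) + total (advance u R)
          ≡⟨ cong₂ _+_
               (trans (val-⊕ h D _) (cong (λ f → val h D + val h (send graph u f)) (advance-same u R u≢v)))
               (total-advance u R u≢v) ⟩
        (val h D + s) + (total R + (weight u (ρ u e) - weight u e))
          -- Regrouping isolates the left side of `Balanced`.
          ≡⟨ lemma₁ (val h D) s (total R) (weight u (ρ u e)) (weight u e) ⟩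
        (val h D + (total R - weight u e)) + (weight u (ρ u e) + s)
          ≈⟨ ≋-+ (≡⇒≋ {val h D + (total R - weight u e)} refl) (balanced u e (atSource u u≢v)) ⟩
        (val h D + (total R - weight u e)) + weight u e
          ≡⟨ lemma₂ (val h D) (total R) (weight u e) ⟩
        val h D + total R ∎

  -- Rotor routing by computation

  State : Set
  State = Vec ℤ n × Vec (Fin #E) n

  routeState : Fin n → State → State
  routeState u (d , r) =
    tabulate (λ w → lookup d w + send graph u (ρ u (lookup r u)) w) , r [ u ]≔ ρ u (lookup r u)

  active? : ∀ d → Dec (∃[ u ] u ≢ v × 0ℤ < lookup d u)
  active? d = any? λ u → ¬? (u ≟ v) ×-dec (0ℤ ℤ.<? lookup d u)

  -- The number bounds the routing steps, so termination is not presupposed; it is read off from the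
  -- final state.
  simulate : ℕ → State → State
  simulate zero    s = s
  simulate (suc k) s with active? (proj₁ s)
  ... | yes (u , _) = simulate k (routeState u s)
  ... | no  _       = s

  -- The rotor entry of a state at `v` is a placeholder and is not compared.
  Represents : State → Div n → Rotors → Set
  Represents (d , r) D R = (∀ w → D w ≡ lookup d w) × (∀ w (w≢v : w ≢ v) → R w w≢v ≡ lookup r w)

  represents-route : ∀ {s D R} u (u≢v : u ≢ v) → Represents s D R →
    Represents (routeState u s) (D ⊕ send graph u (advance u R u u≢v)) (advance u R)
  represents-route {d , r} {D} {R} u u≢v (D≗d , R≗r) = chips≗ , rotors≗
    where
    rotor≡ : advance u R u u≢v ≡ ρ u (lookup r u)
    rotor≡ = trans (advance-same u R u≢v) (cong (ρ u) (R≗r u u≢v))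
    chips≗ : ∀ w → (D ⊕ send graph u (advance u R u u≢v)) w ≡ lookup (proj₁ (routeState u (d , r))) w
    chips≗ w = trans (cong₂ (λ x e → x + send graph u e w) (D≗d w) rotor≡)
      (sym (lookup∘tabulate (λ w → lookup d w + send graph u (ρ u (lookup r u)) w) w))
    rotors≗ : ∀ w (w≢v : w ≢ v) → advance u R w w≢v ≡ lookup (r [ u ]≔ ρ u (lookup r u)) w
    rotors≗ w w≢v = go (w ≟ u)
      where
      go : Dec (w ≡ u) → advance u R w w≢v ≡ lookup (r [ u ]≔ ρ u (lookup r u)) w
      go (yes refl) = trans rotor≡ (sym (lookup∘update u r (ρ u (lookup r u))))
      go (no w≢u) = trans (advance-other u R w≢v w≢u)
        (trans (R≗r w w≢v) (sym (lookup∘update′ w≢u r (ρ u (lookup r u)))))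

  -- Each computed step is a legal routing step, so evaluating `simulate` produces an actual run.
  simulate-run : ∀ k s {D R} → Represents s D R →
    ∃[ D′ ] ∃[ R′ ] Star _⟶_ (D , R) (D′ , R′) × Represents (simulate k s) D′ R′
  simulate-run zero    s rep = _ , _ , ε , rep
  simulate-run (suc k) s {D} {R} rep with active? (proj₁ s)
  ... | no _ = _ , _ , ε , rep
  ... | yes (u , u≢v , 0<d) =
    let (D′ , R′ , run , rep′) = simulate-run k (routeState u s) (represents-route {s} u u≢v rep)
    in D′ , R′ , route u u≢v (subst (0ℤ <_) (sym (proj₁ rep u)) 0<d) ◅ run , rep′

firstReturn-unique : ∀ {n} (H : RibbonGraph n) {T s k k′} →
  Bernardi.FirstReturn H T s k → Bernardi.FirstReturn H T s k′ → k ≡ k′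
firstReturn-unique H {k = k} {k′} (0<k , returns , first) (0<k′ , returns′ , first′) with ℕ.<-cmp k k′
... | tri< k<k′ _ _ = contradiction returns (first′ k 0<k k<k′)
... | tri≈ _ k≡k′ _ = k≡k′
... | tri> _ _ k′<k = contradiction returns′ (first k′ 0<k′ k′<k)

-- Wedges of two banana graphs

successor : ∀ {k} → Fin (suc k) → Fin (suc k)
successor {k} i = suc (toℕ i) mod suc k

module Wedge (m n : ℕ) where

  -- Successors, so that neither bundle of parallel edges is empty.
  p q : ℕ
  p = suc m
  q = suc n

  Edge : Set
  Edge = Fin (p ℕ.+ q)

  far : Edge → Fin 3
  far e = [ const 1F , const 2F ]′ (splitAt p e)

  far≢0 : ∀ e → 0F ≢ far e
  far≢0 e with splitAt p e
  ... | inj₁ _ = λ ()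
  ... | inj₂ _ = λ ()

  multigraph : Multigraph 3
  multigraph = record { #E = p ℕ.+ q ; ends = λ e → 0F , far e ; loopless = far≢0 }

  open Multigraph multigraph
    using (Incident; incident?; other; other-incident; Walk; stop; step; edges; vertices; IsCycle; Connected; Acyclic; IsSpanningTree)

  near : Fin p → Edge
  near = _↑ˡ q

  aft : Fin q → Edge
  aft = p ↑ʳ_

  far-near : ∀ i → far (near i) ≡ 1F
  far-near i = cong [ const 1F , const 2F ]′ (splitAt-↑ˡ p i q)

  far-aft : ∀ j → far (aft j) ≡ 2F
  far-aft j = cong [ const 1F , const 2F ]′ (splitAt-↑ʳ p q j)

  far-1 : ∀ e → 1F ≡ far e → ∃[ i ] e ≡ near i
  far-1 e eq with splitAt p e | join-splitAt p q e
  ... | inj₁ i | e≡ = i , sym e≡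
  far-1 e () | inj₂ _ | _

  far-2 : ∀ e → 2F ≡ far e → ∃[ j ] e ≡ aft j
  far-2 e eq with splitAt p e | join-splitAt p q e
  far-2 e () | inj₁ _ | _
  ... | inj₂ j | e≡ = j , sym e≡

  -- Spanning trees of a wedge: one edge from each bundle

  pair : Edge → Edge → Subset (p ℕ.+ q)
  pair a b = ⁅ a ⁆ ∪ ⁅ b ⁆

  ∈pair⁻ : ∀ {a b e} → e ∈ pair a b → e ≡ a ⊎ e ≡ b
  ∈pair⁻ = map (x∈⁅y⁆⇒x≡y _) (x∈⁅y⁆⇒x≡y _) ∘ x∈p∪q⁻ _ _

  ∈pairˡ : ∀ a b → a ∈ pair a b
  ∈pairˡ a b = x∈p∪q⁺ (inj₁ (x∈⁅x⁆ a))

  ∈pairʳ : ∀ a b → b ∈ pair a b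
  ∈pairʳ a b = x∈p∪q⁺ (inj₂ (x∈⁅x⁆ b))

  outward : ∀ {A} e {w} → e ∈ A → w ≡ far e → Walk A 0F w
  outward e e∈A refl = step e e∈A (inj₁ refl) stop

  other-far : ∀ e {u} → u ≡ far e → other e u ≡ 0F
  other-far e refl with far e | far≢0 e
  ... | 0F    | 0≢0 = contradiction refl 0≢0
  ... | suc _ | _   = refl

  inward : ∀ {A} e {u} {w} → e ∈ A → u ≡ far e → Walk A 0F w → Walk A u w
  inward {A} e {w = w} e∈A eq walk =
    step e e∈A (inj₂ eq) (subst (λ x → Walk A x w) (sym (other-far e eq)) walk)

  connects : ∀ {A} a b → a ∈ A → b ∈ A → 1F ≡ far a → 2F ≡ far b → Connected A
  connects {A} a b a∈A b∈A far-a far-b = go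
    where
    out : ∀ w → Walk A 0F w
    out 0F = stop
    out 1F = outward a a∈A far-a
    out 2F = outward b b∈A far-b
    go : Connected A
    go 0F w = out w
    go 1F w = inward a a∈A far-a (out w)
    go 2F w = inward b b∈A far-b (out w)

  graph : Graph 3
  graph = record
    { multigraph = multigraph
    ; nonEmpty   = _
    ; connected  = connects (near 0F) (aft 0F) ∈⊤ ∈⊤ (sym (far-near 0F)) (sym (far-aft 0F))
    }

  other≢ : ∀ {u e} → Incident u e → other e u ≢ u
  other≢ {e = e} (inj₁ refl) eq = far≢0 e (sym eq)
  other≢ {e = e} (inj₂ refl) eq with far e | far≢0 e
  ... | 0F    | 0≢0 = 0≢0 refl
  ... | suc _ | _   = case eq of λ ()

  common⇒0 : ∀ {u a b} → 1F ≡ far a → 2F ≡ far b → Incident u a → Incident u b → u ≡ 0F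
  common⇒0 far-a far-b (inj₁ u≡0) _          = u≡0
  common⇒0 far-a far-b (inj₂ _)   (inj₁ u≡0) = u≡0
  common⇒0 far-a far-b (inj₂ u≡a) (inj₂ u≡b) = case trans far-a (trans (sym u≡a) (trans u≡b (sym far-b))) of λ ()

  -- A one-edge cycle would be a loop. In a two-edge cycle both vertices would lie on `a` and on
  -- `b`, whose only common vertex is 0. Three edges drawn from `a` and `b` repeat one.
  pair-acyclic : ∀ a b → 1F ≡ far a → 2F ≡ far b → Acyclic (pair a b)
  pair-acyclic a b far-a far-b walk (nonempty , unique , _) = go walk refl nonempty unique
    where
    common : ∀ {u e f} → e ∈ pair a b → f ∈ pair a b → e ≢ f → Incident u e → Incident u f → u ≡ 0F
    common e∈ f∈ e≢f ie if with ∈pair⁻ e∈ | ∈pair⁻ f∈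
    ... | inj₁ refl | inj₁ refl = contradiction refl e≢f
    ... | inj₁ refl | inj₂ refl = common⇒0 {a = a} {b} far-a far-b ie if
    ... | inj₂ refl | inj₁ refl = common⇒0 {a = a} {b} far-a far-b if ie
    ... | inj₂ refl | inj₂ refl = contradiction refl e≢f
    -- The two ends are related by an equation so that the walk can be matched on.
    go : ∀ {u w} (walk : Walk (pair a b) u w) → w ≡ u → edges walk ≢ List.[] → ¬ Unique (edges walk)
    go stop _ nonempty _ = nonempty refl
    go (step e _ i stop) eq _ _ = other≢ {e = e} i eq
    go (step {u} e e∈ i (step f f∈ j stop)) eq _ ((e≢f All.∷ All.[]) AllPairs.∷ _) = other≢ {e = e} i (trans w≡0 (sym u≡0))
      where
      w≡0 = common e∈ f∈ e≢f (other-incident e u) j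
      u≡0 = common e∈ f∈ e≢f i (subst (λ x → Incident x f) eq (other-incident f (other e u)))
    go (step e e∈ _ (step f f∈ _ (step g g∈ _ _))) _ _ ((e≢f All.∷ e≢g All.∷ _) AllPairs.∷ (f≢g All.∷ _) AllPairs.∷ _)
      with ∈pair⁻ e∈ | ∈pair⁻ f∈ | ∈pair⁻ g∈
    ... | inj₁ refl | inj₁ refl | _         = e≢f refl
    ... | inj₁ refl | inj₂ refl | inj₁ refl = e≢g refl
    ... | inj₁ refl | inj₂ refl | inj₂ refl = f≢g refl
    ... | inj₂ refl | inj₂ refl | _         = e≢f refl
    ... | inj₂ refl | inj₁ refl | inj₂ refl = e≢g refl
    ... | inj₂ refl | inj₁ refl | inj₁ refl = f≢g refl

  pair-isSpanningTree : ∀ i j → IsSpanningTree (pair (near i) (aft j))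
  pair-isSpanningTree i j =
    connects (near i) (aft j) (∈pairˡ (near i) (aft j)) (∈pairʳ (near i) (aft j)) (sym (far-near i)) (sym (far-aft j)) ,
    pair-acyclic (near i) (aft j) (sym (far-near i)) (sym (far-aft j))

  leaving : ∀ {A u w} → u ≢ w → Walk A u w → ∃[ e ] e ∈ A × Incident u e
  leaving u≢w stop           = contradiction refl u≢w
  leaving _   (step e e∈A i _) = e , e∈A , i

  module _ {A : Subset (p ℕ.+ q)} where

    -- The end of a two-edge walk from 0 equals 0 only propositionally; the walk is closed along
    -- that equation.
    closing : ∀ {u w} → u ≡ w → Walk A u w
    closing refl = stop

    edges-closing : ∀ {u w} (eq : u ≡ w) → edges (closing eq) ≡ List.[]
    edges-closing refl = refl

    vertices-closing : ∀ {u w} (eq : u ≡ w) → vertices (closing eq) ≡ List.[]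
    vertices-closing refl = refl

  -- Two distinct parallel edges would form a cycle of length two.
  acyclic⇒¬parallel : ∀ {A} → Acyclic A → ∀ e f → e ∈ A → f ∈ A → far e ≡ far f → e ≡ f
  acyclic⇒¬parallel {A} acyclic e f e∈A f∈A far≡ with e ≟ f
  ... | yes e≡f = e≡f
  ... | no  e≢f = contradiction cycle (acyclic walk)
    where
    back : other f (far e) ≡ 0F
    back = other-far f far≡
    walk : Walk A 0F 0F
    walk = step e e∈A (inj₁ refl) (step f f∈A (inj₂ far≡) (closing back))
    cycle : IsCycle walk
    cycle rewrite edges-closing {A} back | vertices-closing {A} back =
      (λ ()) ,
      ((e≢f All.∷ All.[]) AllPairs.∷ All.[] AllPairs.∷ AllPairs.[]) ,
      ((far≢0 e All.∷ All.[]) AllPairs.∷ All.[] AllPairs.∷ AllPairs.[])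

  spanningTree-pair : ∀ {A} → IsSpanningTree A → ∃[ i ] ∃[ j ] A ≡ pair (near i) (aft j)
  spanningTree-pair {A} (connected , acyclic)
    with leaving (λ ()) (connected 1F 0F) | leaving (λ ()) (connected 2F 0F)
  ... | a , a∈A , inj₂ far-a | b , b∈A , inj₂ far-b with far-1 a far-a | far-2 b far-b
  ... | i , a≡ | j , b≡ = i , j , trans (⊆-antisym A⊆ ⊆A) (cong₂ pair a≡ b≡)
    where
    A⊆ : ∀ {e} → e ∈ A → e ∈ pair a b
    A⊆ {e} e∈A with far e in far-e
    ... | 0F = contradiction (sym far-e) (far≢0 e)
    ... | 1F = subst (_∈ pair a b) (acyclic⇒¬parallel acyclic a e a∈A e∈A (trans (sym far-a) (sym far-e))) (∈pairˡ a b)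
    ... | 2F = subst (_∈ pair a b) (acyclic⇒¬parallel acyclic b e b∈A e∈A (trans (sym far-b) (sym far-e))) (∈pairʳ a b)
    ⊆A : ∀ {e} → e ∈ pair a b → e ∈ A
    ⊆A e∈ with ∈pair⁻ {a} {b} e∈
    ... | inj₁ refl = a∈A
    ... | inj₂ refl = b∈A

  -- Around 0 the first bundle is followed by the second. Around 1 and 2 the edges run in the same
  -- direction as around 0; the reversed direction would give a plane embedding. Values at
  -- non-incident edges are arbitrary.
  rotation : Fin 3 → Edge → Edge
  rotation 0F e = successor e
  rotation 1F e = [ near ∘ successor , aft ]′ (splitAt p e)
  rotation 2F e = [ near , aft ∘ successor ]′ (splitAt p e)

  Rotates : Set
  Rotates = (∀ u e → Incident u e → Incident u (rotation u e)) ×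
    (∀ u e e′ → Incident u e → Incident u e′ → ∃[ k ] fold e (rotation u) (toℕ {p ℕ.+ q} k) ≡ e′)

  rotates? : Dec Rotates
  rotates? =
    (all? λ u → all? λ e → incident? u e →-dec incident? u (rotation u e)) ×-dec
    (all? λ u → all? λ e → all? λ e′ → incident? u e →-dec (incident? u e′ →-dec
      any? λ k → fold e (rotation u) (toℕ k) ≟ e′))

  ribbon : Rotates → RibbonGraph 3
  ribbon (incident , cyclic) = record
    { graph      = graph
    ; ρ          = rotation
    ; ρ-incident = λ {u} {e} → incident u e
    ; ρ-cyclic   = λ {u} {e} {e′} i i′ → let (k , eq) = cyclic u e e′ i i′ in toℕ k , eq
    }

-- The torsors of a wedge with Picard group ℤ/6

-- Rooting at 1 puts the rotor of the first bundle at 0 instead of at 1, which reverses its weight.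
-- The second bundle contributes a multiple of 3, whose sign is immaterial modulo 6.
sign : Fin 3 → ℤ
sign 0F = 1ℤ
sign 1F = -1ℤ
sign 2F = 1ℤ

-- canonical v k has value ≋ k, because 2 h₀ ≋ 0 in both graphs.
canonical : Fin 3 → ℤ → Div 3
canonical 0F k = - (k + k) ∷ k ∷ k ∷ []
canonical 1F k = 0ℤ ∷ k - + 6 ∷ + 6 - k ∷ []
canonical 2F k = 0ℤ ∷ k ∷ - k ∷ []

-- For these cyclic orders Bernardi moves tree numbers opposite to rotor routing.
signOf : Process → Fin 3 → ℤ
signOf rotorRouting v = sign v
signOf bernardi     v = - sign v

signOf² : ∀ π v → signOf π v * signOf π v ≡ 1ℤ
signOf² rotorRouting 0F = refl
signOf² rotorRouting 1F = refl
signOf² rotorRouting 2F = refl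
signOf² bernardi     0F = refl
signOf² bernardi     1F = refl
signOf² bernardi     2F = refl

-- `h₀` is the potential of vertex 0; `a` and `b` are to be firing vectors for `α` and `β`.
module WedgeModel (m n : ℕ) (ok : Wedge.Rotates m n) (h₀ : ℤ) (a b : Vector ℤ 3) where
  open Wedge m n

  H : RibbonGraph 3
  H = ribbon ok

  open RibbonGraph H using (#E; Incident; incident?; other; ρ; SpanningTree; HalfEdge; vertex; _≟ₕ_)
  open HalfEdges H using (allHalfEdges?)

  nearEdge aftEdge : Fin 6 → Edge
  nearEdge i = near (toℕ i mod p)
  aftEdge i = aft (toℕ i mod q)

  tree : Fin 6 → Subset #E
  tree i = pair (nearEdge i) (aftEdge i)

  spanningTree : Fin 6 → SpanningTree
  spanningTree i = tree i , pair-isSpanningTree (toℕ i mod p) (toℕ i mod q)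

  -- The rotors of tree i rooted at v; the value at u = v is junk.
  rotor : Fin 3 → Fin 6 → Fin 3 → Edge
  rotor v  i 1F = nearEdge i
  rotor v  i 2F = aftEdge i
  rotor 1F i 0F = nearEdge i
  rotor 2F i 0F = aftEdge i
  rotor 0F i 0F = aftEdge i

  -- Shifted to vanish at the root, so that chips collected there count for nothing.
  potential-at : Fin 3 → Vector ℤ 3
  potential-at v u = potential h₀ u - potential h₀ v

  -- Passing from one edge at u to the next on the same side changes the
  -- weight by h(u) − h(other end), the loss in value of the chip sent.
  weight : Fin 3 → Edge → ℤ
  weight u e = (potential h₀ u - potential h₀ (other e u)) * + suc ([ toℕ , toℕ ]′ (splitAt p e))

  -- 100 routing steps suffice in both graphs.
  finalState : (v : Fin 3) (i k : Fin 6) → Routing.State H v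
  finalState v i k = Routing.simulate H v 100 (tabulate (canonical v ⟦ k ⟧) , tabulate (rotor v i))

  RunsTo : Fin 3 → Fin 6 → Fin 6 → Set
  RunsTo v i k = ∀ u → u ≢ v →
    lookup (proj₁ (finalState v i k)) u ≡ 0ℤ × lookup (proj₂ (finalState v i k)) u ≡ rotor v (move (sign v) i ⟦ k ⟧) u

  runsTo? : ∀ v i k → Dec (RunsTo v i k)
  runsTo? v i k = all? λ u → ¬? (u ≟ v) →-dec
    ((lookup (proj₁ (finalState v i k)) u ℤ.≟ 0ℤ) ×-dec (lookup (proj₂ (finalState v i k)) u ≟ rotor v (move (sign v) i ⟦ k ⟧) u))

  open Bernardi H

  -- The tour of a spanning tree passes every half-edge exactly once.
  tourLength : ℕ
  tourLength = 2 ℕ.* #E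

  -- `FirstReturn` at the expected length, with bounded quantifiers to make it decidable.
  FullTour : Subset #E → HalfEdge → Set
  FullTour T s = fold s (next T) tourLength ≡ s ×
    (∀ (j : Fin tourLength) → 0 ℕ.< toℕ j → fold s (next T) (toℕ j) ≢ s)

  fullTour? : ∀ T s → Dec (FullTour T s)
  fullTour? T s = (fold s (next T) tourLength ≟ₕ s) ×-dec
    (all? λ j → (0 ℕ.<? toℕ j) →-dec ¬? (fold s (next T) (toℕ j) ≟ₕ s))

  tourChips : HalfEdge → Fin 6 → Div 3
  tourChips s i = chips (tree i) List.[] (List.iterate (next (tree i)) s tourLength)

  module _ (v : Fin 3) where
    open Routing.Invariant H v (potential-at v) weight public

  total-at : Fin 3 → Fin 6 → ℤ
  total-at v i = total v (λ u _ → rotor v i u)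

  -- The facts about a particular wedge that are left to finite computation.
  record Certificate : Set where
    field
      -- In both graphs `p` and `q` are coprime with product 6, so this is the Chinese remainder
      -- theorem.
      exhaustive     : ∀ i j → ∃[ k ] near i ≡ nearEdge k × aft j ≡ aftEdge k
      tree-injective : ∀ i j → tree i ≡ tree j → i ≡ j
      harmonic       : Harmonic (potential h₀) graph
      harmonic-at    : ∀ v → Harmonic (potential-at v) graph
      fire-a         : ∀ w → fire graph a w ≡ α h₀ w
      fire-b         : ∀ w → fire graph b w ≡ β h₀ w
      -- Passing between bundles at 0, or from the last edge of a bundle to its first, works because
      -- last edges have weight ≋ 0.
      balanced       : ∀ v → Balanced v
      total-affine   : ∀ v → Affine (sign v) (total-at v)
      runsTo         : ∀ v i k → RunsTo v i k
      canonical-deg  : ∀ v (k : Fin 6) → deg (canonical v ⟦ k ⟧) ≡ 0ℤ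
      canonical-val  : ∀ v k → val (potential h₀) (canonical v ⟦ k ⟧) ≋ ⟦ k ⟧
      canonical-nonneg : ∀ v (k : Fin 6) u → u ≢ v → 0ℤ ≤ canonical v ⟦ k ⟧ u
      fullTour       : ∀ s i → FullTour (tree i) s
      -- This is |E| - |V| + 1 with three vertices.
      tour-deg       : ∀ s i → deg (tourChips s i) ≡ + #E - + 2
      -- The sign depends only on the base vertex, so all starting edges there give the same action.
      tour-affine    : ∀ s → Affine (- sign (vertex s)) (λ i → val (potential h₀) (tourChips s i))

  certificate? : Dec Certificate
  certificate? = map′
    (λ (exhaustive , tree-injective , harmonic , harmonic-at , fire-a , fire-b , balanced , total-affine , runsTo ,
        canonical-deg , canonical-val , canonical-nonneg , fullTour , tour-deg , tour-affine) → record
      { exhaustive = exhaustive ; tree-injective = tree-injective ; harmonic = harmonic ; harmonic-at = harmonic-at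
      ; fire-a = fire-a ; fire-b = fire-b ; balanced = balanced ; total-affine = total-affine ; runsTo = runsTo
      ; canonical-deg = canonical-deg ; canonical-val = canonical-val ; canonical-nonneg = canonical-nonneg
      ; fullTour = fullTour ; tour-deg = tour-deg ; tour-affine = tour-affine
      })
    (λ c → let open Certificate c in exhaustive , tree-injective , harmonic , harmonic-at , fire-a , fire-b , balanced ,
      total-affine , runsTo , canonical-deg , canonical-val , canonical-nonneg , fullTour , tour-deg , tour-affine)
    ( (all? λ i → all? λ j → any? λ k → (near i ≟ nearEdge k) ×-dec (aft j ≟ aftEdge k))
    ×-dec (all? λ i → all? λ j → ≡-dec Bool._≟_ (tree i) (tree j) →-dec (i ≟ j))
    ×-dec harmonic? (potential h₀) graph
    ×-dec (all? λ v → harmonic? (potential-at v) graph)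
    ×-dec (all? λ w → fire graph a w ℤ.≟ α h₀ w)
    ×-dec (all? λ w → fire graph b w ℤ.≟ β h₀ w)
    ×-dec (all? λ v → all? λ u → all? λ e → incident? u e →-dec
      (weight u (ρ u e) + val (potential-at v) (send graph u (ρ u e)) ≋? weight u e))
    ×-dec (all? λ v → affine? (sign v) (total-at v))
    ×-dec (all? λ v → all? λ i → all? λ k → runsTo? v i k)
    ×-dec (all? λ v → all? λ k → deg (canonical v ⟦ k ⟧) ℤ.≟ 0ℤ)
    ×-dec (all? λ v → all? λ k → val (potential h₀) (canonical v ⟦ k ⟧) ≋? ⟦ k ⟧)
    ×-dec (all? λ v → all? λ k → all? λ u → ¬? (u ≟ v) →-dec (0ℤ ℤ.≤? canonical v ⟦ k ⟧ u))
    ×-dec (allHalfEdges? λ s → all? λ i → fullTour? (tree i) s)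
    ×-dec (allHalfEdges? λ s → all? λ i → deg (tourChips s i) ℤ.≟ + #E - + 2)
    ×-dec (allHalfEdges? λ s → affine? (- sign (vertex s)) (λ i → val (potential h₀) (tourChips s i)))
    )

generators : Subset 3
generators = outside Vec.∷ inside Vec.∷ inside Vec.∷ Vec.[]

-- The potential is 1 at vertex 1 and 0 at vertex 2 in both graphs, so this divisor has value `x` in
-- either.
dipole : ℤ → Div⁰ 3
dipole x = (0ℤ ∷ x ∷ - x ∷ []) , lemma x
  where
  lemma : ∀ x → 0ℤ + (x + (- x + 0ℤ)) ≡ 0ℤ
  lemma = solve-∀

dipole-supported : ∀ x → SupportedOn generators (dipole x)
dipole-supported x 0F _   = refl
dipole-supported x 1F 1∉V = contradiction (there here) 1∉V
dipole-supported x 2F 2∉V = contradiction (there (there here)) 2∉V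

-- From the certificate to the torsors

module WedgeTorsor (m n : ℕ) (ok : Wedge.Rotates m n) (h₀ : ℤ) (a b : Vector ℤ 3)
  (certificate : WedgeModel.Certificate m n ok h₀ a b) where

  open Wedge m n
  open WedgeModel m n ok h₀ a b
  open Certificate certificate
  open RibbonGraph H using (#E; Incident; SpanningTree; IsSpanningTree; HalfEdge; half; vertex)

  infix 4 _∼ᴴ_
  _∼ᴴ_ : Div 3 → Div 3 → Set
  _∼ᴴ_ = _∼_ graph

  value : Div 3 → ℤ
  value = val (potential h₀)

  ∼⇒value≋ : ∀ {D D′} → D ∼ᴴ D′ → value D ≋ value D′
  ∼⇒value≋ {D} {D′} = ∼⇒val≋ (potential h₀) graph harmonic {D} {D′}

  value≋⇒∼ : ∀ {D D′} → deg D ≡ deg D′ → value D ≋ value D′ → D ∼ᴴ D′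
  value≋⇒∼ {D} {D′} = val≋⇒∼ h₀ graph a b fire-a fire-b {D} {D′}

  far-nearEdge : ∀ i → far (nearEdge i) ≡ 1F
  far-nearEdge i = far-near (toℕ i mod p)

  far-aftEdge : ∀ i → far (aftEdge i) ≡ 2F
  far-aftEdge i = far-aft (toℕ i mod q)

  ¬incident-1 : ∀ i → ¬ Incident 1F (aftEdge i)
  ¬incident-1 i (inj₂ 1≡) with () ← trans 1≡ (far-aftEdge i)

  ¬incident-2 : ∀ i → ¬ Incident 2F (nearEdge i)
  ¬incident-2 i (inj₂ 2≡) with () ← trans 2≡ (far-nearEdge i)

  ∈tree⁻ : ∀ i {e} → e ∈ tree i → e ≡ nearEdge i ⊎ e ≡ aftEdge i
  ∈tree⁻ i = ∈pair⁻ {nearEdge i} {aftEdge i}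

  nearEdge∈tree : ∀ i → nearEdge i ∈ tree i
  nearEdge∈tree i = ∈pairˡ (nearEdge i) (aftEdge i)

  aftEdge∈tree : ∀ i → aftEdge i ∈ tree i
  aftEdge∈tree i = ∈pairʳ (nearEdge i) (aftEdge i)

  ∈tree-at-1 : ∀ i {e} → e ∈ tree i → Incident 1F e → e ≡ nearEdge i
  ∈tree-at-1 i e∈ at with ∈tree⁻ i e∈
  ... | inj₁ e≡   = e≡
  ... | inj₂ refl = contradiction at (¬incident-1 i)

  ∈tree-at-2 : ∀ i {e} → e ∈ tree i → Incident 2F e → e ≡ aftEdge i
  ∈tree-at-2 i e∈ at with ∈tree⁻ i e∈
  ... | inj₁ refl = contradiction at (¬incident-2 i)
  ... | inj₂ e≡   = e≡

  module _ (v : Fin 3) where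
    open RotorRouting H v

    rotors : Fin 6 → Rotors
    rotors i u _ = rotor v i u

    -- A rotor from 0 to a vertex other than the root is followed by the rotor back.
    trapped : ∀ {R k e} (0≢v : 0F ≢ v) → suc k ≢ v → far e ≡ suc k → R 0F 0≢v ≡ e →
      ∀ {u} → u ≡ 0F ⊎ u ≡ suc k → ¬ LeadsToRoot R u
    trapped 0≢v w≢v far-e R0≡e (inj₁ refl) here = 0≢v refl
    trapped 0≢v w≢v far-e R0≡e (inj₂ refl) here = w≢v refl
    trapped 0≢v w≢v far-e R0≡e (inj₁ refl) (there _ l) =
      trapped 0≢v w≢v far-e R0≡e (inj₂ (trans (cong far R0≡e) far-e)) l
    trapped 0≢v w≢v far-e R0≡e (inj₂ refl) (there _ l) =
      trapped 0≢v w≢v far-e R0≡e (inj₁ refl) l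

  -- Vertices 1 and 2 each meet a single tree edge. At 0 the tree edge away from the root is
  -- excluded by `trapped`.
  oriented⇒rotors : ∀ v i {R} → RotorRouting.OrientsTowards H v (tree i) R → ∀ u u≢v → R u u≢v ≡ rotor v i u
  oriented⇒rotors v i (at , leads) 1F u≢v = let (e∈ , inc) = at 1F u≢v in ∈tree-at-1 i e∈ inc
  oriented⇒rotors v i (at , leads) 2F u≢v = let (e∈ , inc) = at 2F u≢v in ∈tree-at-2 i e∈ inc
  oriented⇒rotors 0F i (at , leads) 0F u≢v = contradiction refl u≢v
  oriented⇒rotors 1F i {R} (at , leads) 0F u≢v with ∈tree⁻ i (proj₁ (at 0F u≢v))
  ... | inj₁ e≡ = e≡
  ... | inj₂ e≡ = contradiction (leads 0F) (trapped 1F {R} (λ ()) (λ ()) (far-aftEdge i) e≡ (inj₁ refl))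
  oriented⇒rotors 2F i {R} (at , leads) 0F u≢v with ∈tree⁻ i (proj₁ (at 0F u≢v))
  ... | inj₁ e≡ = contradiction (leads 0F) (trapped 2F {R} (λ ()) (λ ()) (far-nearEdge i) e≡ (inj₁ refl))
  ... | inj₂ e≡ = e≡

  rotor∈tree : ∀ v i u → u ≢ v → rotor v i u ∈ tree i × Incident u (rotor v i u)
  rotor∈tree v  i 1F _   = nearEdge∈tree i , inj₂ (sym (far-nearEdge i))
  rotor∈tree v  i 2F _   = aftEdge∈tree i , inj₂ (sym (far-aftEdge i))
  rotor∈tree 0F i 0F 0≢0 = contradiction refl 0≢0
  rotor∈tree 1F i 0F _   = nearEdge∈tree i , inj₁ refl
  rotor∈tree 2F i 0F _   = aftEdge∈tree i , inj₁ refl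

  rotors-oriented : ∀ v i → RotorRouting.OrientsTowards H v (tree i) (rotors v i)
  rotors-oriented v i = (λ u u≢v → rotor∈tree v i u u≢v) , leads v
    where
    open RotorRouting using (LeadsToRoot; here; there)
    leads : ∀ v u → LeadsToRoot H v (rotors v i) u
    leads 0F 0F = here
    leads 0F 1F = there (λ ()) here
    leads 0F 2F = there (λ ()) here
    leads 1F 0F = there (λ ()) (subst (LeadsToRoot H 1F (rotors 1F i)) (sym (far-nearEdge i)) here)
    leads 1F 1F = here
    leads 1F 2F = there (λ ()) (leads 1F 0F)
    leads 2F 0F = there (λ ()) (subst (LeadsToRoot H 2F (rotors 2F i)) (sym (far-aftEdge i)) here)
    leads 2F 1F = there (λ ()) (leads 2F 0F)
    leads 2F 2F = here

  rotors-form : ∀ v i {R} → (∀ u (u≢v : u ≢ v) → R u u≢v ≡ rotor v i u) → RotorRouting.Forms H v R (tree i)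
  rotors-form v i {R} R≗ e = mk⇔ (λ e∈ → locate v R≗ (∈tree⁻ i e∈))
    (λ (u , u≢v , eq) → subst (_∈ tree i) (trans (sym (R≗ u u≢v)) eq) (proj₁ (rotor∈tree v i u u≢v)))
    where
    locate : ∀ v {R : RotorRouting.Rotors H v} → (∀ u (u≢v : u ≢ v) → R u u≢v ≡ rotor v i u) →
      e ≡ nearEdge i ⊎ e ≡ aftEdge i → Σ[ u ∈ Fin 3 ] Σ[ u≢v ∈ u ≢ v ] R u u≢v ≡ e
    locate 0F R≗ (inj₁ refl) = 1F , (λ ()) , R≗ 1F λ ()
    locate 0F R≗ (inj₂ refl) = 2F , (λ ()) , R≗ 2F λ ()
    locate 1F R≗ (inj₁ refl) = 0F , (λ ()) , R≗ 0F λ ()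
    locate 1F R≗ (inj₂ refl) = 2F , (λ ()) , R≗ 2F λ ()
    locate 2F R≗ (inj₁ refl) = 1F , (λ ()) , R≗ 1F λ ()
    locate 2F R≗ (inj₂ refl) = 0F , (λ ()) , R≗ 0F λ ()

  -- For a root other than 0, the tree edge between 0 and the root misses the third vertex, so it
  -- can only be the rotor at 0.
  forms⇒rotors : ∀ v i {R} → RotorRouting.Forms H v R (tree i) → AtSource v R → ∀ u u≢v → R u u≢v ≡ rotor v i u
  forms⇒rotors v i forms at 1F u≢v = ∈tree-at-1 i (Equivalence.from (forms _) (1F , u≢v , refl)) (at 1F u≢v)
  forms⇒rotors v i forms at 2F u≢v = ∈tree-at-2 i (Equivalence.from (forms _) (2F , u≢v , refl)) (at 2F u≢v)
  forms⇒rotors 0F i forms at 0F u≢v = contradiction refl u≢v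
  forms⇒rotors 1F i forms at 0F u≢v with Equivalence.to (forms (nearEdge i)) (nearEdge∈tree i)
  ... | 0F , _ , eq   = eq
  ... | 1F , 1≢1 , _  = contradiction refl 1≢1
  ... | 2F , 2≢1 , eq = contradiction (subst (Incident 2F) eq (at 2F 2≢1)) (¬incident-2 i)
  forms⇒rotors 2F i forms at 0F u≢v with Equivalence.to (forms (aftEdge i)) (aftEdge∈tree i)
  ... | 0F , _ , eq   = eq
  ... | 1F , 1≢2 , eq = contradiction (subst (Incident 1F) eq (at 1F 1≢2)) (¬incident-1 i)
  ... | 2F , 2≢2 , _  = contradiction refl 2≢2

  -- Shifting the potential by a constant changes the value by a multiple of the degree.
  val-at-deg0 : ∀ v (S : Div⁰ 3) → val (potential-at v) (proj₁ S) ≡ value (proj₁ S)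
  val-at-deg0 v (S , deg0) = begin
    val (potential-at v) S                   ≡⟨ lemma h₀ 1ℤ 0ℤ (potential h₀ v) (S 0F) (S 1F) (S 2F) ⟩
    value S + - (potential h₀ v) * deg S     ≡⟨ cong (λ d → value S + - (potential h₀ v) * d) deg0 ⟩
    value S + - (potential h₀ v) * 0ℤ        ≡⟨ cong (_+_ (value S)) (ℤ.*-zeroʳ (- (potential h₀ v))) ⟩
    value S + 0ℤ                             ≡⟨ ℤ.+-identityʳ (value S) ⟩
    value S                                  ∎
    where
    open ≡-Reasoning
    lemma : ∀ h k l x s t u → (h - x) * s + ((k - x) * t + ((l - x) * u + 0ℤ)) ≡
      h * s + (k * t + (l * u + 0ℤ)) + - x * (s + (t + (u + 0ℤ)))
    lemma = solve-∀

  -- All remaining chips lie at `v`, where the potential vanishes.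
  val-at-finished : ∀ v {D} → (∀ u → u ≢ v → D u ≡ 0ℤ) → val (potential-at v) D ≡ 0ℤ
  val-at-finished v {D} finished = sum-cong-≗ {x = λ u → potential-at v u * D u} {y = λ _ → 0ℤ} zero-term
    where
    zero-term : ∀ u → potential-at v u * D u ≡ 0ℤ
    zero-term u with u ≟ v
    ... | yes refl = cong (_* D v) (ℤ.+-inverseʳ (potential h₀ v))
    ... | no u≢v   = trans (cong (potential-at v u *_) (finished u u≢v)) (ℤ.*-zeroʳ (potential-at v u))

  -- For any representative and routing order, conservation equates `total-at v j` with
  -- `total-at v i` plus the value of `S` modulo 6, which determines `j`.
  rotor-sound : ∀ v S i j → RotorRouting.Result H v S (tree i) (tree j) → move (sign v) i (value (proj₁ S)) ≡ j
  rotor-sound v S i j result = affine⇒move (sign v) (signOf² rotorRouting v) (total-at v) (total-affine v) i j (value (proj₁ S)) (begin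
    total-at v i + value (proj₁ S)                     ≡⟨ cong₂ _+_ (total-cong v {R} {rotors v i} R≗) (val-at-deg0 v S) ⟨
    total v R + val (potential-at v) (proj₁ S)         ≈⟨ ≋-+ (≡⇒≋ {total v R} refl) (∼⇒val≋ (potential-at v) graph (harmonic-at v) {D} {proj₁ S} represents) ⟨
    total v R + val (potential-at v) D                 ≡⟨ ℤ.+-comm (total v R) (val (potential-at v) D) ⟩
    val (potential-at v) D + total v R                 ≈⟨ proj₂ conserved ⟩
    val (potential-at v) D′ + total v R′               ≡⟨ cong₂ _+_ (val-at-finished v finished) (total-cong v {R′} {rotors v j} R′≗) ⟩
    0ℤ + total-at v j                                  ≡⟨ ℤ.+-identityˡ (total-at v j) ⟩
    total-at v j                                       ∎)
    where
    open RotorRouting.Result result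
    open ≋-Reasoning
    conserved = invariant v (balanced v) (λ u u≢v → proj₂ (proj₁ oriented u u≢v)) run
    R≗ : ∀ u u≢v → R u u≢v ≡ rotor v i u
    R≗ = oriented⇒rotors v i oriented
    R′≗ : ∀ u u≢v → R′ u u≢v ≡ rotor v j u
    R′≗ = forms⇒rotors v j forms (proj₁ conserved)

  -- The canonical divisor with the value of `S` is equivalent to `S`, and its computed run ends at
  -- the required tree.
  rotor-complete : ∀ v S i → RotorRouting.Result H v S (tree i) (tree (move (sign v) i (value (proj₁ S))))
  rotor-complete v (S , deg0) i = record
    { represents  = value≋⇒∼ {canonical v ⟦ k ⟧} {S} (trans (canonical-deg v k) (sym deg0)) (≋-trans (canonical-val v k) k≋)
    ; nonnegative = canonical-nonneg v k
    ; oriented    = rotors-oriented v i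
    ; run         = run
    ; finished    = λ u u≢v → trans (D′≗ u) (proj₁ (runsTo v i k u u≢v))
    ; forms       = rotors-form v _ (λ u u≢v → trans (R′≗ u u≢v) (trans (proj₂ (runsTo v i k u u≢v))
        (cong (λ j → rotor v j u) (move-cong (sign v) i k≋))))
    }
    where
    k = residue (value S)
    k≋ : ⟦ k ⟧ ≋ value S
    k≋ = residue-≋ (value S)
    simulation = Routing.simulate-run H v 100 (tabulate (canonical v ⟦ k ⟧) , tabulate (rotor v i))
      {canonical v ⟦ k ⟧} {rotors v i}
      ((λ u → sym (lookup∘tabulate (canonical v ⟦ k ⟧) u)) , (λ u _ → sym (lookup∘tabulate (rotor v i) u)))
    run = proj₁ (proj₂ (proj₂ simulation))
    D′≗ = proj₁ (proj₂ (proj₂ (proj₂ simulation)))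
    R′≗ = proj₂ (proj₂ (proj₂ (proj₂ simulation)))

  open Bernardi H using (FirstReturn; TourDivisor)

  tour-first : ∀ s i → FirstReturn (tree i) s tourLength
  tour-first s i = let (returns , first) = fullTour s i in
    ℕ.z<s , returns , λ j 0<j j<k eq →
      first (fromℕ< j<k) (subst (0 ℕ.<_) (sym (toℕ-fromℕ< j<k)) 0<j)
        (trans (cong (fold s (Bernardi.next H (tree i))) (toℕ-fromℕ< j<k)) eq)

  tourDivisor : ∀ s i → TourDivisor s (tree i) (tourChips s i)
  tourDivisor s i = tourLength , tour-first s i , refl

  tourDivisor-unique : ∀ {s i D} → TourDivisor s (tree i) D → D ≡ tourChips s i
  tourDivisor-unique {s} {i} (k , first , refl) =
    cong (λ k → Bernardi.chips H (tree i) List.[] (List.iterate (Bernardi.next H (tree i)) s k))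
      (firstReturn-unique H {tree i} {s} first (tour-first s i))

  halfEdgeAt : ∀ v → Σ[ s ∈ HalfEdge ] vertex s ≡ v
  halfEdgeAt 0F = half (near 0F) 0F (inj₁ refl) , refl
  halfEdgeAt 1F = half (near 0F) 1F (inj₂ (sym (far-near 0F))) , refl
  halfEdgeAt 2F = half (aft 0F) 2F (inj₂ (sym (far-aft 0F))) , refl

  -- Equivalent divisors have congruent values, and for a fixed start the value of a tour divisor
  -- determines its tree.
  bernardi-sound : ∀ v S i j → Bernardi.Result H v S (tree i) (tree j) → move (- sign v) i (value (proj₁ S)) ≡ j
  bernardi-sound v S i j result = affine⇒move (- sign v) (signOf² bernardi v) chipValue
    (subst (λ u → Affine (- sign u) chipValue) at-v (tour-affine start)) i j (value (proj₁ S)) (begin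
      chipValue i + value (proj₁ S)    ≡⟨ cong (λ D → value D + value (proj₁ S)) (tourDivisor-unique {start} {i} divisor) ⟨
      value D + value (proj₁ S)        ≡⟨ val-⊕ (potential h₀) D (proj₁ S) ⟨
      value (D ⊕ proj₁ S)              ≈⟨ ∼⇒value≋ {D′} {D ⊕ proj₁ S} equivalent ⟨
      value D′                         ≡⟨ cong value (tourDivisor-unique {start} {j} divisor′) ⟩
      chipValue j                      ∎)
    where
    open Bernardi.Result result
    open ≋-Reasoning hiding (start)
    chipValue : Fin 6 → ℤ
    chipValue i = value (tourChips start i)

  deg-⊕ : ∀ (D D′ : Div 3) → deg (D ⊕ D′) ≡ deg D + deg D′
  deg-⊕ D D′ = lemma (D 0F) (D 1F) (D 2F) (D′ 0F) (D′ 1F) (D′ 2F)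
    where
    lemma : ∀ a b c x y z → a + x + (b + y + (c + z + 0ℤ)) ≡ (a + (b + (c + 0ℤ))) + (x + (y + (z + 0ℤ)))
    lemma = solve-∀

  -- The tree number is chosen to make the values agree; the degrees agree too, so the divisors are
  -- equivalent.
  bernardi-complete : ∀ v S i → Bernardi.Result H v S (tree i) (tree (move (- sign v) i (value (proj₁ S))))
  bernardi-complete v (S , deg0) i with halfEdgeAt v
  ... | s , refl = record
    { start      = s
    ; at-v       = refl
    ; divisor    = tourDivisor s i
    ; divisor′   = tourDivisor s j
    ; equivalent = value≋⇒∼ {tourChips s j} {tourChips s i ⊕ S} degrees
        (≋-trans (≋-sym (affine-move (- sign v) (signOf² bernardi v) (λ i → value (tourChips s i)) (tour-affine s) i (value S)))
          (≡⇒≋ (sym (val-⊕ (potential h₀) (tourChips s i) S))))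
    }
    where
    j = move (- sign v) i (value S)
    open ≡-Reasoning
    degrees : deg (tourChips s j) ≡ deg (tourChips s i ⊕ S)
    degrees = begin
      deg (tourChips s j)             ≡⟨ trans (tour-deg s j) (sym (tour-deg s i)) ⟩
      deg (tourChips s i)             ≡⟨ ℤ.+-identityʳ _ ⟨
      deg (tourChips s i) + 0ℤ        ≡⟨ cong (_+_ (deg (tourChips s i))) deg0 ⟨
      deg (tourChips s i) + deg S     ≡⟨ deg-⊕ (tourChips s i) S ⟨
      deg (tourChips s i ⊕ S)         ∎

  tree-complete : ∀ (T : SpanningTree) → Σ[ i ∈ Fin 6 ] proj₁ T ≡ tree i
  tree-complete (A , isTree) with spanningTree-pair isTree
  ... | i , j , A≡ with exhaustive i j
  ... | k , near≡ , aft≡ = k , trans A≡ (cong₂ pair near≡ aft≡)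

  index : SpanningTree → Fin 6
  index T = proj₁ (tree-complete T)

  tree-index : ∀ T → proj₁ T ≡ tree (index T)
  tree-index T = proj₂ (tree-complete T)

  index-cong : ∀ {T T′ : SpanningTree} → proj₁ T ≡ proj₁ T′ → index T ≡ index T′
  index-cong {T} {T′} T≡T′ = tree-injective _ _ (trans (sym (tree-index T)) (trans T≡T′ (tree-index T′)))

  index-spanningTree : ∀ i → index (spanningTree i) ≡ i
  index-spanningTree i = tree-injective _ _ (sym (tree-index (spanningTree i)))

  torsor : ∀ π → Torsor π H
  torsor π = record
    { act     = λ v S T → spanningTree (move (signOf π v) (index T) (value (proj₁ S)))
    ; outcome = λ v S T T′ → mk⇔ (sound π v S T T′) (complete π v S T T′)
    }
    where
    sound : ∀ π v S T T′ → Yields π H v S T T′ → tree (move (signOf π v) (index T) (value (proj₁ S))) ≡ proj₁ T′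
    sound rotorRouting v S T T′ result = trans
      (cong tree (rotor-sound v S (index T) (index T′)
        (subst₂ (RotorRouting.Result H v S) (tree-index T) (tree-index T′) result)))
      (sym (tree-index T′))
    sound bernardi v S T T′ result = trans
      (cong tree (bernardi-sound v S (index T) (index T′)
        (subst₂ (Bernardi.Result H v S) (tree-index T) (tree-index T′) result)))
      (sym (tree-index T′))
    complete : ∀ π v S T T′ → tree (move (signOf π v) (index T) (value (proj₁ S))) ≡ proj₁ T′ → Yields π H v S T T′
    complete rotorRouting v S T T′ eq =
      subst₂ (RotorRouting.Result H v S) (sym (tree-index T)) eq (rotor-complete v S (index T))
    complete bernardi v S T T′ eq =
      subst₂ (Bernardi.Result H v S) (sym (tree-index T)) eq (bernardi-complete v S (index T))

  -- On `generators` the value does not see `h₀`, so both graphs assign the same one. Hence `γ̂`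
  -- preserves values.
  value-supported : ∀ D → SupportedOn generators D → value (proj₁ D) ≡ proj₁ D 1F
  value-supported (D , _) supported = trans
    (cong (λ x → h₀ * x + (1ℤ * D 1F + (0ℤ * D 2F + 0ℤ))) (supported 0F λ ()))
    (lemma h₀ (D 1F) (D 2F))
    where
    lemma : ∀ h x y → h * 0ℤ + (1ℤ * x + (0ℤ * y + 0ℤ)) ≡ x
    lemma = solve-∀

  representable : ∀ S → Σ[ D ∈ Div⁰ 3 ] SupportedOn generators D × proj₁ D ∼ᴴ proj₁ S
  representable S = dipole (value (proj₁ S)) , dipole-supported _ ,
    value≋⇒∼ {proj₁ (dipole (value (proj₁ S)))} {proj₁ S} (trans (proj₂ (dipole (value (proj₁ S)))) (sym (proj₂ S)))
      (≡⇒≋ (value-supported (dipole (value (proj₁ S))) (dipole-supported _)))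

-- The two graphs

open RibbonGraph using (graph; SpanningTree; Genus)
open Torsor using (act)

abstract
  rotates : Wedge.Rotates 2 1
  rotates = from-yes (Wedge.rotates? 2 1)

  rotates′ : Wedge.Rotates 5 0
  rotates′ = from-yes (Wedge.rotates? 5 0)

-- Harmonicity at 1 and 2 reads p(h₀ - 1) ≋ 0 and q h₀ ≋ 0, which gives h₀ = 3 for (3 , 2) and h₀ =
-- 0 for (6 , 1). The two vectors solve `fire-a` and `fire-b` with coefficient 0 at vertex 0.
module W = WedgeModel 2 1 rotates (+ 3) (0ℤ ∷ 1ℤ ∷ -1ℤ ∷ []) (0ℤ ∷ - + 2 ∷ + 3 ∷ [])
module W′ = WedgeModel 5 0 rotates′ 0ℤ (0ℤ ∷ 0ℤ ∷ 1ℤ ∷ []) (0ℤ ∷ -1ℤ ∷ + 6 ∷ [])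

abstract
  certificate : W.Certificate
  certificate = from-yes W.certificate?

  certificate′ : W′.Certificate
  certificate′ = from-yes W′.certificate?

module T = WedgeTorsor 2 1 rotates (+ 3) (0ℤ ∷ 1ℤ ∷ -1ℤ ∷ []) (0ℤ ∷ - + 2 ∷ + 3 ∷ []) certificate
module T′ = WedgeTorsor 5 0 rotates′ 0ℤ (0ℤ ∷ 0ℤ ∷ 1ℤ ∷ []) (0ℤ ∷ -1ℤ ∷ + 6 ∷ []) certificate′

genus-1 : Genus W.H 1
-- Two cycles: 2 - 3 + 5 - 2 = 2 · 1.
genus-1 = 2 , cyc (bases r s) (cycleOf r s) (from-yes (transversal? (bases r s) (cycleOf r s))) , refl
  where
  open RibbonGraph W.H using (half)
  open HalfEdges W.H
  r = half 0F 0F (inj₁ refl)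
  s = half (suc 2F) 2F (inj₂ refl)

genus-2 : Genus W′.H 2
-- Two cycles: 2 - 3 + 7 - 2 = 2 · 2.
genus-2 = 2 , cyc (bases r s) (cycleOf r s) (from-yes (transversal? (bases r s) (cycleOf r s))) , refl
  where
  open RibbonGraph W′.H using (half)
  open HalfEdges W′.H
  r = half 0F 0F (inj₁ refl)
  s = half 0F 1F (inj₂ refl)

property1 : Property1 (graph W.H) (graph W′.H) generators
property1 = T.representable , T′.representable

-- In either graph equivalence means that the chip counts at vertex 1 agree modulo 6.
property2 : Property2 (graph W.H) (graph W′.H) generators
property2 D D′ supp supp′ = mk⇔
  (λ D∼D′ → T′.value≋⇒∼ {proj₁ D} {proj₁ D′} deg≡ (subst₂ _≋_
    (trans (T.value-supported D supp) (sym (T′.value-supported D supp)))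
    (trans (T.value-supported D′ supp′) (sym (T′.value-supported D′ supp′)))
    (T.∼⇒value≋ {proj₁ D} {proj₁ D′} D∼D′)))
  (λ D∼D′ → T.value≋⇒∼ {proj₁ D} {proj₁ D′} deg≡ (subst₂ _≋_
    (trans (T′.value-supported D supp) (sym (T.value-supported D supp)))
    (trans (T′.value-supported D′ supp′) (sym (T.value-supported D′ supp′)))
    (T′.∼⇒value≋ {proj₁ D} {proj₁ D′} D∼D′)))
  where
  deg≡ : deg (proj₁ D) ≡ deg (proj₁ D′)
  deg≡ = trans (proj₂ D) (sym (proj₂ D′))

treeBijection : Bijection (𝒯 (graph W.H)) (𝒯 (graph W′.H))
treeBijection = record
  { to        = λ T → W′.spanningTree (T.index T)
  ; cong      = λ {T} {T′} T≡T′ → cong W′.tree (T.index-cong {T} {T′} T≡T′)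
  ; bijective =
      (λ {T} {T′} eq → trans (T.tree-index T)
        (trans (cong W.tree (W′.Certificate.tree-injective certificate′ (T.index T) (T.index T′) eq)) (sym (T.tree-index T′))))
    , λ T′ → W.spanningTree (T′.index T′) , λ {T} eq → trans
        (cong W′.tree (trans (T.index-cong {T} {W.spanningTree (T′.index T′)} eq) (T.index-spanningTree (T′.index T′))))
        (sym (T′.tree-index T′))
  }

theorem1p6 : (α : Process) →
    Σ[ n ∈ ℕ ] Σ[ G ∈ RibbonGraph n ] Σ[ G′ ∈ RibbonGraph n ]
    (∃[ g ] ∃[ g′ ] Genus G g × Genus G′ g′ × g ≢ g′) ×
    (Σ[ Vgen ∈ Subset n ]
    Σ[ P1 ∈ Property1 (graph G) (graph G′) Vgen ]
    Σ[ P2 ∈ Property2 (graph G) (graph G′) Vgen ]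
    Σ[ φ ∈ Bijection (𝒯 (graph G)) (𝒯 (graph G′)) ]
    Σ[ A ∈ Torsor α G ] Σ[ A′ ∈ Torsor α G′ ]
    ((v : Fin n) (S : Div⁰ n) (T : SpanningTree G) →
    Setoid._≈_ (𝒯 (graph G′))
    (Bijection.to φ (act A v S T))
    (act A′ v (Func.to (γ̂ (graph G) (graph G′) Vgen P1 P2) S) (Bijection.to φ T))))
theorem1p6 π =
  3 , W.H , W′.H , (1 , 2 , genus-1 , genus-2 , λ ()) ,
  generators , property1 , property2 , treeBijection , T.torsor π , T′.torsor π , equivariant
  where
  equivariant : ∀ v S T → W′.tree (T.index (W.spanningTree (move (signOf π v) (T.index T) (T.value (proj₁ S)))))
    ≡ W′.tree (move (signOf π v) (T′.index (W′.spanningTree (T.index T))) (T′.value (proj₁ (proj₁ (T.representable S)))))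
  -- Both sides translate the number of `T` by the value of `S`: `γ̂` returns the dipole of that
  -- value, which keeps its value in the second graph.
  equivariant v S T = cong W′.tree (trans
    (T.index-spanningTree (move (signOf π v) (T.index T) (T.value (proj₁ S))))
    (cong₂ (move (signOf π v))
      (sym (T′.index-spanningTree (T.index T)))
      (sym (T′.value-supported (dipole (T.value (proj₁ S))) (dipole-supported (T.value (proj₁ S)))))))
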